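{- Let $p$ be an odd prime and let $\mathcal{L}=(L_1,\dots,L_m)$ be a system of linear forms in $d$ variables with coefficients in $\mathbb{F}_p$, written $L_i(x_1,\dots,x_d)=\sum_{r=1}^d\gamma^{(i)}_r x_r$. Suppose that the $d\times d$ matrices $\Gamma^{(i)}=(\gamma^{(i)}_r\gamma^{(i)}_s)_{r,s=1}^d$, $i=1,\dots,m$, are linearly dependent over $\mathbb{F}_p$ (i.e. the quadratic forms $L_i^TL_i$ are linearly dependent). Then there exists $\epsilon>0$ such that for every $\delta>0$ there exist $n$ and a set $A\subset\mathbb{F}_p^n$, of density $\alpha=|A|/p^n$, with the following two properties: (i) the balanced function $f=1_A-\alpha$ satisfies $\|f\|_{U^2}\le\delta$; (ii) if $\mathbf{x}=(x_1,\dots,x_d)$ is chosen uniformly at random from $(\mathbb{F}_p^n)^d$, then the probability that $L_i(\mathbf{x})\in A$ for every $i=1,\dots,m$ is at least $\alpha^m+\epsilon$.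
   Context: For $\mathbf{x}=(x_1,\dots,x_d)\in(\mathbb{F}_p^n)^d$, $L_i(\mathbf{x})=\sum_r\gamma^{(i)}_r x_r\in\mathbb{F}_p^n$. For $f:\mathbb{F}_p^n\to\mathbb{C}$, the $U^2$-norm is defined by $\|f\|_{U^2}^4=\mathbb{E}_{x,h_1,h_2\in\mathbb{F}_p^n}f(x)\overline{f(x+h_1)}\,\overline{f(x+h_2)}f(x+h_1+h_2)$, expectations being uniform averages. $1_A$ denotes the characteristic function of $A$. -}

module Defs where

open import Algebra.Definitions.RawSemiring using () renaming (_^_ to pow)
open import Data.Bool.Base using (if_then_else_)
open import Data.Fin.Base using (Fin; toℕ)
open import Data.Integer.Base using (+_)
open import Data.List.Base using (List; []; _∷_; length; map; foldr; filter; allFin; cartesianProductWith)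
open import Data.List.Properties using (length-++; length-map)
open import Data.Nat.Base as ℕ using (ℕ; zero; suc; NonZero)
open import Data.Nat.DivMod using (_mod_)
open import Data.Nat.Properties using (m^n≢0)
open import Data.Product.Base using (_×_; Σ-syntax; ∃-syntax)
open import Data.Rational.Base using (ℚ; 0ℚ; 1ℚ; _+_; _*_; _-_; _/_; _≤_; +-*-rawSemiring)
open import Data.Vec.Base as Vec using (Vec; []; _∷_; lookup; zipWith; replicate)
import Data.Vec.Functional as Vector
open import Level using (Level)
open import Relation.Binary.PropositionalEquality using (_≡_; _≢_; refl; sym; trans; cong; cong₂; subst)
open import Relation.Nullary.Decidable.Core using (does)
open import Relation.Unary using (Pred; Decidable)

private
  variable
    a ℓ : Level
    d m n p : ℕ

infixr 8 _^_
_^_ : ℚ → ℕ → ℚ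
_^_ = pow +-*-rawSemiring

-- The prime field 𝔽_p, as residues {0, …, p-1} with arithmetic modulo p.

𝔽 : ℕ → Set
𝔽 p = Fin p

infixl 6 _+ₚ_
infixl 7 _*ₚ_

0ₚ : .{{_ : NonZero p}} → 𝔽 p
0ₚ {p} = 0 mod p

_+ₚ_ : .{{_ : NonZero p}} → 𝔽 p → 𝔽 p → 𝔽 p
_+ₚ_ {p} x y = (toℕ x ℕ.+ toℕ y) mod p

_*ₚ_ : .{{_ : NonZero p}} → 𝔽 p → 𝔽 p → 𝔽 p
_*ₚ_ {p} x y = (toℕ x ℕ.* toℕ y) mod p

sumₚ : .{{_ : NonZero p}} → (Fin m → 𝔽 p) → 𝔽 p
sumₚ = Vector.foldr _+ₚ_ 0ₚ

-- The space 𝔽_p^n.  `Vec` rather than functions, so that propositional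
-- equality of vectors is coordinatewise equality.

𝔽^ : ℕ → ℕ → Set
𝔽^ p n = Vec (𝔽 p) n

infixl 6 _+ᵥ_
infixl 7 _·ᵥ_

0ᵥ : .{{_ : NonZero p}} → 𝔽^ p n
0ᵥ = replicate _ 0ₚ

_+ᵥ_ : .{{_ : NonZero p}} → 𝔽^ p n → 𝔽^ p n → 𝔽^ p n
_+ᵥ_ = zipWith _+ₚ_

_·ᵥ_ : .{{_ : NonZero p}} → 𝔽 p → 𝔽^ p n → 𝔽^ p n
c ·ᵥ v = Vec.map (c *ₚ_) v

LinearForm : ℕ → ℕ → Set
LinearForm p d = Fin d → 𝔽 p

-- Evaluation L(x₁, …, x_d) = Σ_r γ_r x_r at a d-tuple of vectors in 𝔽_p^n.
eval : .{{_ : NonZero p}} → LinearForm p d → Vec (𝔽^ p n) d → 𝔽^ p n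
eval γ x = Vector.foldr _+ᵥ_ 0ᵥ (λ r → γ r ·ᵥ lookup x r)

Matrix : ℕ → ℕ → Set
Matrix p d = Fin d → Fin d → 𝔽 p

Γ : .{{_ : NonZero p}} → LinearForm p d → Matrix p d
Γ γ r s = γ r *ₚ γ s

LinearlyDependent : .{{_ : NonZero p}} → (Fin m → Matrix p d) → Set
LinearlyDependent {p = p} {m = m} M =
  Σ[ c ∈ (Fin m → 𝔽 p) ] (∃[ i ] c i ≢ 0ₚ) × (∀ r s → sumₚ (λ i → c i *ₚ M i r s) ≡ 0ₚ)

-- All vectors of length n with entries in a given list; repetition-free
-- whenever the given list is.
vectors : {A : Set a} → List A → (n : ℕ) → List (Vec A n)
vectors xs zero    = [] ∷ []
vectors xs (suc n) = cartesianProductWith _∷_ xs (vectors xs n)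

all𝔽^ : (p n : ℕ) → List (𝔽^ p n)
all𝔽^ p n = vectors (allFin p) n

allTuples : (p n d : ℕ) → List (Vec (𝔽^ p n) d)
allTuples p n d = vectors (all𝔽^ p n) d

length-product : {A B C : Set a} (f : A → B → C) (xs : List A) (ys : List B) →
                 length (cartesianProductWith f xs ys) ≡ length xs ℕ.* length ys
length-product f []       ys = refl
length-product f (x ∷ xs) ys =
  trans (length-++ (map (f x) ys))
        (cong₂ ℕ._+_ (length-map (f x) ys) (length-product f xs ys))

length-vectors : {A : Set a} (xs : List A) (n : ℕ) → length (vectors xs n) ≡ length xs ℕ.^ n
length-vectors xs zero    = refl
length-vectors xs (suc n) =
  trans (length-product _∷_ xs (vectors xs n))
        (cong (length xs ℕ.*_) (length-vectors xs n))

-- Deliberately not instances: as such they make instance search loop on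
-- goals `NonZero p` whose p is not yet solved.

vectors-nonEmpty : {A : Set a} (xs : List A) (n : ℕ) .{{_ : NonZero (length xs)}} →
                   NonZero (length (vectors xs n))
vectors-nonEmpty xs n =
  subst NonZero (sym (length-vectors xs n)) (m^n≢0 (length xs) n)

all𝔽^-nonEmpty : (p n : ℕ) .{{_ : NonZero p}} → NonZero (length (all𝔽^ p n))
all𝔽^-nonEmpty p@(suc _) n = vectors-nonEmpty (allFin p) n

allTuples-nonEmpty : (p n d : ℕ) .{{_ : NonZero p}} → NonZero (length (allTuples p n d))
allTuples-nonEmpty p n d = vectors-nonEmpty (all𝔽^ p n) d {{all𝔽^-nonEmpty p n}}

-- Average and probability with respect to the uniform distribution on the
-- entries of a list (used only for repetition-free exhaustive lists).

𝔼 : {A : Set a} (xs : List A) .{{_ : NonZero (length xs)}} → (A → ℚ) → ℚ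
𝔼 xs f = foldr _+_ 0ℚ (map f xs) * (+ 1 / length xs)

Pr : {A : Set a} (xs : List A) .{{_ : NonZero (length xs)}} {P : Pred A ℓ} → Decidable P → ℚ
Pr xs P? = + length (filter P? xs) / length xs

𝔼ᵥ : .{{_ : NonZero p}} → (𝔽^ p n → ℚ) → ℚ
𝔼ᵥ {p = p} {n = n} = 𝔼 (all𝔽^ p n) {{all𝔽^-nonEmpty p n}}

Pr-tuple : .{{_ : NonZero p}} {P : Pred (Vec (𝔽^ p n) d) ℓ} → Decidable P → ℚ
Pr-tuple {p = p} {n = n} {d = d} = Pr (allTuples p n d) {{allTuples-nonEmpty p n d}}

density : .{{_ : NonZero p}} {A : Pred (𝔽^ p n) ℓ} → Decidable A → ℚ
density {p = p} {n = n} = Pr (all𝔽^ p n) {{all𝔽^-nonEmpty p n}}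

indicator : {A : Pred (𝔽^ p n) ℓ} → Decidable A → 𝔽^ p n → ℚ
indicator A? x = if does (A? x) then 1ℚ else 0ℚ

balanced : .{{_ : NonZero p}} {A : Pred (𝔽^ p n) ℓ} → Decidable A → 𝔽^ p n → ℚ
balanced A? x = indicator A? x - density A?

-- ‖f‖⁴ for the U² norm.  The functions considered are rational-valued, so
-- the complex conjugates in the defining formula are the identity.
‖_‖U²^4 : .{{_ : NonZero p}} → (𝔽^ p n → ℚ) → ℚ
‖ f ‖U²^4 =
  𝔼ᵥ λ x → 𝔼ᵥ λ h₁ → 𝔼ᵥ λ h₂ →
    f x * f (x +ᵥ h₁) * f (x +ᵥ h₂) * f (x +ᵥ h₁ +ᵥ h₂)

-- ‖f‖ ≤ δ for δ ≥ 0: the norm itself, a fourth root, need not be rational.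
‖_‖U²≤_ : .{{_ : NonZero p}} → (𝔽^ p n → ℚ) → ℚ → Set
‖ f ‖U²≤ δ = ‖ f ‖U²^4 ≤ δ ^ 4

{-# OPTIONS --safe #-}
-- On 𝔽_p^{k+k} take A = {(a , b) : a · b = 0}.  For fixed a the map
-- b ↦ (Lᵢ(a) · Lᵢ(b))ᵢ is linear, and a linear dependence between the Γ⁽ⁱ⁾ puts
-- its image into a hyperplane of 𝔽_p^m, so its kernel has density at least
-- p^{1-m}; hence so does the event that every Lᵢ(x) lies in A.  On the other
-- hand α is close to 1/p, and ‖1_A - α‖⁴ in U² equals
-- 𝔼_h C(h)² - α⁴ with C(h) = 𝔼_x 1_A(x) 1_A(x + h).  For linearly independent
-- a and w the conditions a · b = 0 and w · (b + v) = 0 on b hold with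
-- probability exactly p^{-2}, so C(h) ≤ p^{-2} + (a term exponentially small
-- in k on average), while α ≥ 1/p.

module Submission where

open import Defs
open import Algebra.Bundles using (CommutativeSemiring)
import Algebra.Properties.CommutativeMonoid.Sum as CommutativeMonoidSum
open import Algebra.Properties.CommutativeSemigroup using (interchange; x∙yz≈y∙xz)
import Algebra.Properties.Semiring.Sum as SemiringSum
open import Algebra.Structures using (IsCommutativeMonoid)
open import Algebra.Structures.Biased using (isCommutativeMonoidˡ; isCommutativeSemiringˡ)
open import Data.Bool.Base using (false; if_then_else_; true)
open import Data.Fin.Base using (Fin; suc; toℕ; zero)
open import Data.Fin.Permutation using (permutation)
open import Data.Fin.Properties using (all?; suc-injective; toℕ-fromℕ<; toℕ-injective; toℕ<n) renaming (_≟_ to _≟ᶠ_)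
open import Data.Integer.Base as ℤ using (+[1+_]; -[1+_])
import Data.Integer.Properties as ℤ
open import Data.List.Base using (List; []; _∷_; allFin; cartesianProductWith; filter; foldr; length; map) renaming (_++_ to _++ˡ_; tabulate to tabulateˡ)
open import Data.List.Properties using (length-tabulate)
open import Data.Nat.Base as ℕ using (NonZero; nonTrivial⇒n>1; suc; s≤s; zero; z≤n; ℕ)
open import Data.Nat.Coprimality using (coprime-Bézout; prime⇒coprime)
open import Data.Nat.DivMod using (%-distribˡ-*; %-distribˡ-+; _%_; _mod_; m%n<n; m*n%n≡0; m<n⇒m%n≡m; n%n≡0)
open import Data.Nat.Divisibility using (_∤_)
open import Data.Nat.GCD using (module Bézout)
open import Data.Nat.Primality using (Prime; prime⇒nonTrivial)
import Data.Nat.Properties as ℕ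
open import Data.Product.Base using (_,_; _×_; proj₁; proj₂; Σ-syntax; ∃-syntax)
open import Data.Rational.Base using (*<*; -_; 0ℚ; 1ℚ; _*_; _+_; _-_; _/_; _<_; _≤_; _≥_; _⊓_; mkℚ; nonNegative; positive; toℚᵘ; ½; ℚ)
open import Data.Rational.Properties hiding (_≟_)
open import Data.Rational.Solver using (module +-*-Solver)
import Data.Rational.Unnormalised.Base as ℚᵘ
import Data.Rational.Unnormalised.Properties as ℚᵘ
open import Data.Sum.Base using (_⊎_; inj₁; inj₂)
open import Data.Vec.Base using (Vec; []; _++_; _∷_; drop; lookup; tabulate; take; zipWith)
open import Data.Vec.Properties using (++-injective; lookup-replicate; lookup∘tabulate; map-++; tabulate-cong; take++drop≡id; zipWith-++; zipWith-assoc; zipWith-comm; ∷-injective; ≡-dec)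
open import Level using (0ℓ)
open import Relation.Binary.Definitions using (DecidableEquality)
open import Relation.Binary.PropositionalEquality using (_≡_; _≢_; cong; cong₂; isEquivalence; module ≡-Reasoning; refl; subst; subst₂; sym; trans)
open import Relation.Nullary using (contradiction; ¬_)
open import Relation.Nullary.Decidable using (Dec; does; no; yes)
open import Relation.Unary using (Decidable; Pred)
open import Algebra.Definitions.RawMonoid Data.Rational.Base.+-0-rawMonoid using () renaming (_×_ to _·_; sum to sumℚ)

private variable
  d m n p : ℕ
  A B C P Q R : Set

-- Rational inequalities

/-distribʳ-+ : ∀ i j n .{{_ : NonZero n}} → (i / n) + (j / n) ≡ (i ℤ.+ j) / n
/-distribʳ-+ i j n@(suc n-1) = toℚᵘ-injective (begin
  toℚᵘ ((i / n) + (j / n))           ≈⟨ toℚᵘ-homo-+ (i / n) (j / n) ⟩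
  toℚᵘ (i / n) ℚᵘ.+ toℚᵘ (j / n)     ≈⟨ ℚᵘ.+-cong (toℚᵘ-fromℚᵘ (ℚᵘ.mkℚᵘ i n-1)) (toℚᵘ-fromℚᵘ (ℚᵘ.mkℚᵘ j n-1)) ⟩
  ℚᵘ.mkℚᵘ i n-1 ℚᵘ.+ ℚᵘ.mkℚᵘ j n-1   ≈⟨ ℚᵘ.*≡* same ⟩
  ℚᵘ.mkℚᵘ (i ℤ.+ j) n-1              ≈⟨ toℚᵘ-fromℚᵘ (ℚᵘ.mkℚᵘ (i ℤ.+ j) n-1) ⟨
  toℚᵘ ((i ℤ.+ j) / n)               ∎)
  where
  open ℚᵘ.≃-Reasoning
  same : (i ℤ.* ℤ.+ n ℤ.+ j ℤ.* ℤ.+ n) ℤ.* ℤ.+ n ≡ (i ℤ.+ j) ℤ.* (ℤ.+ n ℤ.* ℤ.+ n)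
  same = trans (cong (ℤ._* ℤ.+ n) (sym (ℤ.*-distribʳ-+ (ℤ.+ n) i j))) (ℤ.*-assoc (i ℤ.+ j) (ℤ.+ n) (ℤ.+ n))

·-unitFraction : ∀ c n .{{_ : NonZero n}} → c · (ℤ.+ 1 / n) ≡ ℤ.+ c / n
·-unitFraction zero    n = sym (0/n≡0 n)
·-unitFraction (suc c) n = trans (cong ((ℤ.+ 1 / n) +_) (·-unitFraction c n)) (/-distribʳ-+ (ℤ.+ 1) (ℤ.+ c) n)

n/n≡1 : ∀ n .{{_ : NonZero n}} → ℤ.+ n / n ≡ 1ℚ
n/n≡1 n@(suc n-1) = fromℚᵘ-cong {ℚᵘ.mkℚᵘ (ℤ.+ n) n-1} {ℚᵘ.1ℚᵘ} (ℚᵘ.*≡* (ℤ.*-comm (ℤ.+ n) (ℤ.+ 1)))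

0≤1 : 0ℚ ≤ 1ℚ
0≤1 = nonNegative⁻¹ 1ℚ

0<unitFraction : ∀ n .{{_ : NonZero n}} → 0ℚ < ℤ.+ 1 / n
0<unitFraction n = positive⁻¹ (ℤ.+ 1 / n) {{normalize-pos 1 n}}

≤-+ʳ : ∀ x {y} → 0ℚ ≤ y → x ≤ x + y
≤-+ʳ x 0≤y = subst (_≤ x + _) (+-identityʳ x) (+-monoʳ-≤ x 0≤y)

≤-+ˡ : ∀ {x} y → 0ℚ ≤ x → y ≤ x + y
≤-+ˡ {x} y 0≤x = subst (_≤ x + y) (+-identityˡ y) (+-monoˡ-≤ y 0≤x)

0≤+ : ∀ {x y} → 0ℚ ≤ x → 0ℚ ≤ y → 0ℚ ≤ x + y
0≤+ {x} 0≤x 0≤y = ≤-trans 0≤x (≤-+ʳ x 0≤y)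

*-monoˡ : ∀ {x y z} → 0ℚ ≤ x → y ≤ z → x * y ≤ x * z
*-monoˡ {x} 0≤x = *-monoˡ-≤-nonNeg x {{nonNegative 0≤x}}

*-monoʳ : ∀ {x y z} → 0ℚ ≤ x → y ≤ z → y * x ≤ z * x
*-monoʳ {x} 0≤x = *-monoʳ-≤-nonNeg x {{nonNegative 0≤x}}

0≤* : ∀ {x y} → 0ℚ ≤ x → 0ℚ ≤ y → 0ℚ ≤ x * y
0≤* {x} {y} 0≤x 0≤y = subst (_≤ x * y) (*-zeroʳ x) (*-monoˡ 0≤x 0≤y)

0<* : ∀ {x y} → 0ℚ < x → 0ℚ < y → 0ℚ < x * y
0<* {x} {y} 0<x 0<y = subst (_< x * y) (*-zeroʳ x) (*-monoʳ-<-pos x {{positive 0<x}} 0<y)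

*-mono : ∀ {x y u v} → 0ℚ ≤ y → 0ℚ ≤ u → x ≤ y → u ≤ v → x * u ≤ y * v
*-mono 0≤y 0≤u x≤y u≤v = ≤-trans (*-monoʳ 0≤u x≤y) (*-monoˡ 0≤y u≤v)

0≤^ : ∀ {x} n → 0ℚ ≤ x → 0ℚ ≤ x ^ n
0≤^ zero    0≤x = 0≤1
0≤^ (suc n) 0≤x = 0≤* 0≤x (0≤^ n 0≤x)

0<^ : ∀ {x} n → 0ℚ < x → 0ℚ < x ^ n
0<^ zero    0<x = positive⁻¹ 1ℚ
0<^ (suc n) 0<x = 0<* 0<x (0<^ n 0<x)

^≤1 : ∀ {x} n → 0ℚ ≤ x → x ≤ 1ℚ → x ^ n ≤ 1ℚ
^≤1 zero    0≤x x≤1 = ≤-refl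
^≤1 (suc n) 0≤x x≤1 = *-mono 0≤1 (0≤^ n 0≤x) x≤1 (^≤1 n 0≤x x≤1)

0≤· : ∀ n {x} → 0ℚ ≤ x → 0ℚ ≤ n · x
0≤· zero    0≤x = ≤-refl
0≤· (suc n) 0≤x = 0≤+ 0≤x (0≤· n 0≤x)

·-mono-≤ : ∀ n {x y} → x ≤ y → n · x ≤ n · y
·-mono-≤ zero    x≤y = ≤-refl
·-mono-≤ (suc n) x≤y = +-mono-≤ x≤y (·-mono-≤ n x≤y)

·-*ʳ : ∀ n x y → (n · x) * y ≡ n · (x * y)
·-*ʳ zero    x y = *-zeroˡ y
·-*ʳ (suc n) x y = trans (*-distribʳ-+ y x (n · x)) (cong (x * y +_) (·-*ʳ n x y))

p≤q⇒0≤q-p : ∀ {p q} → p ≤ q → 0ℚ ≤ q - p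
p≤q⇒0≤q-p {p} {q} p≤q = subst (_≤ q - p) (+-inverseʳ p) (+-monoˡ-≤ (- p) p≤q)

-- A positive rational has numerator at least 1, so it is at least the reciprocal of its
-- denominator, and that denominator serves as the multiplier.
archimedean : ∀ {x} → 0ℚ < x → ∃[ n ] 1ℚ ≤ n · x
archimedean {x@(mkℚ +[1+ c ] d-1 _)} 0<x = suc d-1 , (begin
  1ℚ                              ≡⟨ n/n≡1 (suc d-1) ⟨
  ℤ.+ suc d-1 / suc d-1             ≡⟨ ·-unitFraction (suc d-1) (suc d-1) ⟨
  suc d-1 · (ℤ.+ 1 / suc d-1)       ≤⟨ ·-mono-≤ (suc d-1) 1/d≤x ⟩
  suc d-1 · x                     ∎)
  where
  open ≤-Reasoning
  1/d = ℤ.+ 1 / suc d-1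
  1/d≤x : 1/d ≤ x
  1/d≤x = begin
    1/d               ≤⟨ ≤-+ʳ 1/d (0≤· c (<⇒≤ (0<unitFraction (suc d-1)))) ⟩
    1/d + c · 1/d     ≡⟨ ·-unitFraction (suc c) (suc d-1) ⟩
    +[1+ c ] / suc d-1 ≡⟨ ↥p/↧p≡p x ⟩
    x                 ∎
archimedean {mkℚ (ℤ.+ 0) _ _} (*<* (ℤ.+<+ ()))
archimedean {mkℚ -[1+ _ ] _ _} (*<* ())

-- Bernoulli's inequality multiplied out so that no division occurs: the power decays at least like
-- 1 / (1 + n x). The term added in the induction step is exactly what turns (1 - x)(1 + x + n x)
-- into 1 + n x.
bernoulli : ∀ {x} → 0ℚ ≤ x → x ≤ 1ℚ → ∀ n → (1ℚ - x) ^ n * (1ℚ + n · x) ≤ 1ℚ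
bernoulli {x} 0≤x x≤1 zero    = ≤-refl
bernoulli {x} 0≤x x≤1 (suc n) = begin
  (1ℚ - x) * y * (1ℚ + (x + z))
    ≤⟨ ≤-+ʳ _ (0≤* (0≤^ n (p≤q⇒0≤q-p x≤1)) (0≤* 0≤x (0≤+ 0≤x (0≤· n 0≤x)))) ⟩
  (1ℚ - x) * y * (1ℚ + (x + z)) + y * (x * (x + z))
    ≡⟨ solve 3 (λ x y z → (con 1ℚ :- x) :* y :* (con 1ℚ :+ (x :+ z)) :+ y :* (x :* (x :+ z)) := y :* (con 1ℚ :+ z)) refl x y z ⟩
  y * (1ℚ + z)
    ≤⟨ bernoulli 0≤x x≤1 n ⟩
  1ℚ ∎
  where
  open ≤-Reasoning
  open +-*-Solver
  y = (1ℚ - x) ^ n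
  z = n · x

powers-vanish : ∀ {x} → 0ℚ < x → x ≤ 1ℚ → ∀ {τ} → 0ℚ < τ → ∃[ n ] (1ℚ - x) ^ n ≤ τ
powers-vanish {x} 0<x x≤1 {τ} 0<τ with archimedean (0<* 0<x 0<τ)
... | n , 1≤nxτ = n , *-cancelʳ-≤-pos (1ℚ + n · x) {{positive 0<1+nx}} (begin
  (1ℚ - x) ^ n * (1ℚ + n · x)   ≤⟨ bernoulli (<⇒≤ 0<x) x≤1 n ⟩
  1ℚ                            ≤⟨ 1≤nxτ ⟩
  n · (x * τ)                   ≡⟨ ·-*ʳ n x τ ⟨
  n · x * τ                     ≡⟨ *-comm (n · x) τ ⟩
  τ * (n · x)                   ≤⟨ *-monoˡ (<⇒≤ 0<τ) (≤-+ˡ (n · x) 0≤1) ⟩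
  τ * (1ℚ + n · x)              ∎)
  where
  open ≤-Reasoning
  0<1+nx : 0ℚ < 1ℚ + n · x
  0<1+nx = <-≤-trans (positive⁻¹ 1ℚ) (≤-+ʳ 1ℚ (0≤· n (<⇒≤ 0<x)))

-- The n-th power is Lipschitz with constant n on [0, 1]: each factor replaced costs at most z,
-- since all remaining factors are at most 1. This turns α ≤ ρ + θ into a bound for α^m.
^-perturb : ∀ {x y z} → 0ℚ ≤ x → x ≤ 1ℚ → 0ℚ ≤ y → y ≤ 1ℚ → 0ℚ ≤ z → x ≤ y + z →
            ∀ n → x ^ n ≤ y ^ n + n · z
^-perturb 0≤x x≤1 0≤y y≤1 0≤z x≤y+z zero = ≤-refl
^-perturb {x} {y} {z} 0≤x x≤1 0≤y y≤1 0≤z x≤y+z (suc n) = begin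
  x * x ^ n                        ≤⟨ *-monoˡ 0≤x (^-perturb 0≤x x≤1 0≤y y≤1 0≤z x≤y+z n) ⟩
  x * (y ^ n + n · z)              ≡⟨ *-distribˡ-+ x (y ^ n) (n · z) ⟩
  x * y ^ n + x * (n · z)          ≤⟨ +-mono-≤ (*-monoʳ (0≤^ n 0≤y) x≤y+z) (*-monoʳ (0≤· n 0≤z) x≤1) ⟩
  (y + z) * y ^ n + 1ℚ * (n · z)   ≡⟨ cong₂ _+_ (*-distribʳ-+ (y ^ n) y z) (*-identityˡ (n · z)) ⟩
  y * y ^ n + z * y ^ n + n · z    ≤⟨ +-monoˡ-≤ (n · z) (+-monoʳ-≤ (y * y ^ n) (*-monoˡ 0≤z (^≤1 n 0≤y y≤1))) ⟩
  y * y ^ n + z * 1ℚ + n · z       ≡⟨ cong (λ w → y * y ^ n + w + n · z) (*-identityʳ z) ⟩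
  y * y ^ n + z + n · z            ≡⟨ +-assoc (y * y ^ n) z (n · z) ⟩
  y * y ^ n + (z + n · z)          ∎
  where open ≤-Reasoning

-- Indicators and uniform averages over lists

unitFraction-* : ∀ m n .{{_ : NonZero m}} .{{_ : NonZero n}} .{{m*n≢0 : NonZero (m ℕ.* n)}} →
                 ℤ.+ 1 / (m ℕ.* n) ≡ (ℤ.+ 1 / m) * (ℤ.+ 1 / n)
unitFraction-* m@(suc m-1) n@(suc n-1) = toℚᵘ-injective (begin
  toℚᵘ (ℤ.+ 1 / (m ℕ.* n))                       ≈⟨ toℚᵘ-fromℚᵘ (ℚᵘ.mkℚᵘ (ℤ.+ 1) (ℕ.pred (m ℕ.* n))) ⟩
  ℚᵘ.mkℚᵘ (ℤ.+ 1) m-1 ℚᵘ.* ℚᵘ.mkℚᵘ (ℤ.+ 1) n-1   ≈⟨ ℚᵘ.*-cong (toℚᵘ-fromℚᵘ (ℚᵘ.mkℚᵘ (ℤ.+ 1) m-1)) (toℚᵘ-fromℚᵘ (ℚᵘ.mkℚᵘ (ℤ.+ 1) n-1)) ⟨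
  toℚᵘ (ℤ.+ 1 / m) ℚᵘ.* toℚᵘ (ℤ.+ 1 / n)         ≈⟨ toℚᵘ-homo-* (ℤ.+ 1 / m) (ℤ.+ 1 / n) ⟨
  toℚᵘ ((ℤ.+ 1 / m) * (ℤ.+ 1 / n))               ∎)
  where open ℚᵘ.≃-Reasoning

-- The body agrees with that of `indicator`, so `indicator A? x` and `ind (A? x)` are definitionally
-- equal.
ind : Dec P → ℚ
ind P? = if does P? then 1ℚ else 0ℚ

0≤ind : (P? : Dec P) → 0ℚ ≤ ind P?
0≤ind (yes _) = 0≤1
0≤ind (no _)  = ≤-refl

ind≤1 : (P? : Dec P) → ind P? ≤ 1ℚ
ind≤1 (yes _) = ≤-refl
ind≤1 (no _)  = 0≤1

ind-true : (P? : Dec P) → P → ind P? ≡ 1ℚ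
ind-true (yes _) p = refl
ind-true (no ¬p) p = contradiction p ¬p

ind-false : (P? : Dec P) → ¬ P → ind P? ≡ 0ℚ
ind-false (yes p) ¬p = contradiction p ¬p
ind-false (no _)  ¬p = refl

ind-cong : (P? : Dec P) (Q? : Dec Q) → (P → Q) → (Q → P) → ind P? ≡ ind Q?
ind-cong (yes p) Q? f g = sym (ind-true Q? (f p))
ind-cong (no ¬p) Q? f g = sym (ind-false Q? (λ q → ¬p (g q)))

ind-× : (P? : Dec P) (Q? : Dec Q) (R? : Dec R) →
        (R → P × Q) → (P → Q → R) → ind R? ≡ ind P? * ind Q?
ind-× (yes p) (yes q) R? f g = ind-true R? (g p q)
ind-× (yes p) (no ¬q) R? f g = ind-false R? λ r → let _ , q = f r in ¬q q
ind-× (no ¬p) Q?      R? f g = trans (ind-false R? λ r → let p , _ = f r in ¬p p) (sym (*-zeroˡ (ind Q?)))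

∑ : List A → (A → ℚ) → ℚ
∑ xs f = foldr _+_ 0ℚ (map f xs)

∑-cong : ∀ (xs : List A) {f g : A → ℚ} → (∀ x → f x ≡ g x) → ∑ xs f ≡ ∑ xs g
∑-cong []       f≡g = refl
∑-cong (x ∷ xs) f≡g = cong₂ _+_ (f≡g x) (∑-cong xs f≡g)

∑-mono : ∀ (xs : List A) {f g : A → ℚ} → (∀ x → f x ≤ g x) → ∑ xs f ≤ ∑ xs g
∑-mono []       f≤g = ≤-refl
∑-mono (x ∷ xs) f≤g = +-mono-≤ (f≤g x) (∑-mono xs f≤g)

∑-+ : ∀ (xs : List A) (f g : A → ℚ) → ∑ xs (λ x → f x + g x) ≡ ∑ xs f + ∑ xs g
∑-+ []       f g = refl
∑-+ (x ∷ xs) f g = trans (cong (f x + g x +_) (∑-+ xs f g))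
  (solve 4 (λ a b c d → a :+ b :+ (c :+ d) := a :+ c :+ (b :+ d)) refl (f x) (g x) (∑ xs f) (∑ xs g))
  where open +-*-Solver

∑-*ˡ : ∀ (xs : List A) c (f : A → ℚ) → ∑ xs (λ x → c * f x) ≡ c * ∑ xs f
∑-*ˡ []       c f = sym (*-zeroʳ c)
∑-*ˡ (x ∷ xs) c f = trans (cong (c * f x +_) (∑-*ˡ xs c f)) (sym (*-distribˡ-+ c (f x) (∑ xs f)))

∑-const : ∀ (xs : List A) c → ∑ xs (λ _ → c) ≡ length xs · c
∑-const []       c = refl
∑-const (x ∷ xs) c = cong (c +_) (∑-const xs c)

∑-swap : ∀ (xs : List A) (ys : List B) (f : A → B → ℚ) →
         ∑ xs (λ x → ∑ ys (f x)) ≡ ∑ ys (λ y → ∑ xs (λ x → f x y))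
∑-swap []       ys f = sym (trans (∑-const ys 0ℚ) (·-zero (length ys)))
  where
  ·-zero : ∀ n → n · 0ℚ ≡ 0ℚ
  ·-zero zero    = refl
  ·-zero (suc n) = trans (+-identityˡ (n · 0ℚ)) (·-zero n)
∑-swap (x ∷ xs) ys f = trans (cong (∑ ys (f x) +_) (∑-swap xs ys f)) (sym (∑-+ ys (f x) _))

∑-map : ∀ (g : A → B) (xs : List A) f → ∑ (map g xs) f ≡ ∑ xs (λ x → f (g x))
∑-map g []       f = refl
∑-map g (x ∷ xs) f = cong (f (g x) +_) (∑-map g xs f)

∑-++ : ∀ (xs ys : List A) f → ∑ (xs ++ˡ ys) f ≡ ∑ xs f + ∑ ys f
∑-++ []       ys f = sym (+-identityˡ (∑ ys f))
∑-++ (x ∷ xs) ys f = trans (cong (f x +_) (∑-++ xs ys f)) (sym (+-assoc (f x) (∑ xs f) (∑ ys f)))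

∑-product : ∀ (g : A → B → C) (xs : List A) (ys : List B) f →
            ∑ (cartesianProductWith g xs ys) f ≡ ∑ xs (λ x → ∑ ys (λ y → f (g x y)))
∑-product g []       ys f = refl
∑-product g (x ∷ xs) ys f = trans (∑-++ (map (g x) ys) _ f)
  (cong₂ _+_ (∑-map (g x) ys f) (∑-product g xs ys f))

∑-ind : ∀ {P : Pred A 0ℓ} (P? : Decidable P) xs → ∑ xs (λ x → ind (P? x)) ≡ length (filter P? xs) · 1ℚ
∑-ind P? []       = refl
∑-ind P? (x ∷ xs) with does (P? x)
... | true  = cong (1ℚ +_) (∑-ind P? xs)
... | false = trans (+-identityˡ _) (∑-ind P? xs)

-- Later this decides whether a value is attained by a map: a scan of the list either finds a
-- preimage or shows that the fibre has weight 0.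
∑-vanishes-or-witness : ∀ {P : Pred A 0ℓ} (P? : Decidable P) xs →
                          ∑ xs (λ x → ind (P? x)) ≡ 0ℚ ⊎ Σ[ x ∈ A ] P x
∑-vanishes-or-witness P? []       = inj₁ refl
∑-vanishes-or-witness P? (x ∷ xs) with P? x
... | yes p = inj₂ (x , p)
... | no _ with ∑-vanishes-or-witness P? xs
...   | inj₁ eq = inj₁ (trans (+-identityˡ _) eq)
...   | inj₂ w  = inj₂ w

module _ (xs : List A) .{{_ : NonZero (length xs)}} where

  private
    w = ℤ.+ 1 / length xs

    0≤w : 0ℚ ≤ w
    0≤w = <⇒≤ (0<unitFraction (length xs))

  𝔼-cong : {f g : A → ℚ} → (∀ x → f x ≡ g x) → 𝔼 xs f ≡ 𝔼 xs g
  𝔼-cong f≡g = cong (_* w) (∑-cong xs f≡g)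

  𝔼-mono : {f g : A → ℚ} → (∀ x → f x ≤ g x) → 𝔼 xs f ≤ 𝔼 xs g
  𝔼-mono f≤g = *-monoʳ 0≤w (∑-mono xs f≤g)

  𝔼-+ : (f g : A → ℚ) → 𝔼 xs (λ x → f x + g x) ≡ 𝔼 xs f + 𝔼 xs g
  𝔼-+ f g = trans (cong (_* w) (∑-+ xs f g)) (*-distribʳ-+ w (∑ xs f) (∑ xs g))

  𝔼-*ˡ : ∀ c (f : A → ℚ) → 𝔼 xs (λ x → c * f x) ≡ c * 𝔼 xs f
  𝔼-*ˡ c f = trans (cong (_* w) (∑-*ˡ xs c f)) (*-assoc c (∑ xs f) w)

  𝔼-*ʳ : ∀ c (f : A → ℚ) → 𝔼 xs (λ x → f x * c) ≡ 𝔼 xs f * c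
  𝔼-*ʳ c f = trans (𝔼-cong (λ x → *-comm (f x) c)) (trans (𝔼-*ˡ c f) (*-comm c (𝔼 xs f)))

  𝔼-const : ∀ c → 𝔼 xs (λ _ → c) ≡ c
  𝔼-const c = begin
    ∑ xs (λ _ → c) * w       ≡⟨ cong (_* w) (∑-const xs c) ⟩
    (length xs · c) * w      ≡⟨ cong (λ z → (length xs · z) * w) (*-identityˡ c) ⟨
    (length xs · (1ℚ * c)) * w ≡⟨ cong (_* w) (·-*ʳ (length xs) 1ℚ c) ⟨
    (length xs · 1ℚ) * c * w   ≡⟨ solve 3 (λ x y z → x :* y :* z := y :* (x :* z)) refl (length xs · 1ℚ) c w ⟩
    c * ((length xs · 1ℚ) * w) ≡⟨ cong (c *_) (·-*ʳ (length xs) 1ℚ w) ⟩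
    c * (length xs · (1ℚ * w)) ≡⟨ cong (λ z → c * (length xs · z)) (*-identityˡ w) ⟩
    c * (length xs · w)        ≡⟨ cong (c *_) (trans (·-unitFraction (length xs) (length xs)) (n/n≡1 (length xs))) ⟩
    c * 1ℚ                     ≡⟨ *-identityʳ c ⟩
    c                          ∎
    where
    open ≡-Reasoning
    open +-*-Solver

  Pr≡𝔼 : ∀ {P : Pred A 0ℓ} (P? : Decidable P) → Pr xs P? ≡ 𝔼 xs (λ x → ind (P? x))
  Pr≡𝔼 P? = sym (begin
    ∑ xs (λ x → ind (P? x)) * w          ≡⟨ cong (_* w) (∑-ind P? xs) ⟩
    (length (filter P? xs) · 1ℚ) * w     ≡⟨ ·-*ʳ (length (filter P? xs)) 1ℚ w ⟩
    length (filter P? xs) · (1ℚ * w)     ≡⟨ cong (length (filter P? xs) ·_) (*-identityˡ w) ⟩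
    length (filter P? xs) · w            ≡⟨ ·-unitFraction (length (filter P? xs)) (length xs) ⟩
    Pr xs P?                             ∎)
    where open ≡-Reasoning

  𝔼-vanishes-or-witness : ∀ {P : Pred A 0ℓ} (P? : Decidable P) →
                          𝔼 xs (λ x → ind (P? x)) ≡ 0ℚ ⊎ Σ[ x ∈ A ] P x
  𝔼-vanishes-or-witness P? with ∑-vanishes-or-witness P? xs
  ... | inj₁ eq = inj₁ (trans (cong (_* w) eq) (*-zeroˡ w))
  ... | inj₂ x  = inj₂ x

  module _ (ys : List B) .{{_ : NonZero (length ys)}} where

    𝔼-swap : (f : A → B → ℚ) → 𝔼 xs (λ x → 𝔼 ys (f x)) ≡ 𝔼 ys (λ y → 𝔼 xs (λ x → f x y))
    𝔼-swap f = begin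
      ∑ xs (λ x → ∑ ys (f x) * v) * w             ≡⟨ cong (_* w) (∑-*ʳ xs v (λ x → ∑ ys (f x))) ⟩
      ∑ xs (λ x → ∑ ys (f x)) * v * w             ≡⟨ cong (λ z → z * v * w) (∑-swap xs ys f) ⟩
      ∑ ys (λ y → ∑ xs (λ x → f x y)) * v * w     ≡⟨ solve 3 (λ x y z → x :* y :* z := x :* z :* y) refl (∑ ys (λ y → ∑ xs (λ x → f x y))) v w ⟩
      ∑ ys (λ y → ∑ xs (λ x → f x y)) * w * v     ≡⟨ cong (_* v) (∑-*ʳ ys w (λ y → ∑ xs (λ x → f x y))) ⟨
      ∑ ys (λ y → ∑ xs (λ x → f x y) * w) * v     ∎
      where
      open ≡-Reasoning
      open +-*-Solver
      v = ℤ.+ 1 / length ys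
      ∑-*ʳ : ∀ {D : Set} (zs : List D) c (h : D → ℚ) → ∑ zs (λ z → h z * c) ≡ ∑ zs h * c
      ∑-*ʳ zs c h = trans (∑-cong zs (λ z → *-comm (h z) c)) (trans (∑-*ˡ zs c h) (*-comm c (∑ zs h)))

    𝔼-product : (g : A → B → C) .{{_ : NonZero (length (cartesianProductWith g xs ys))}} (f : C → ℚ) →
                𝔼 (cartesianProductWith g xs ys) f ≡ 𝔼 xs (λ x → 𝔼 ys (λ y → f (g x y)))
    𝔼-product g {{nz}} f = begin
      ∑ (cartesianProductWith g xs ys) f * (ℤ.+ 1 / length (cartesianProductWith g xs ys))
        ≡⟨ cong₂ _*_ (∑-product g xs ys f) (trans (/-cong {ℤ.+ 1} {length (cartesianProductWith g xs ys)} {ℤ.+ 1} {length xs ℕ.* length ys} {{nz}} {{nz′}} refl (length-product g xs ys)) (unitFraction-* (length xs) (length ys) {{m*n≢0 = nz′}})) ⟩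
      ∑ xs (λ x → ∑ ys (λ y → f (g x y))) * (w * v)
        ≡⟨ solve 3 (λ x y z → x :* (y :* z) := z :* x :* y) refl _ w v ⟩
      v * ∑ xs (λ x → ∑ ys (λ y → f (g x y))) * w
        ≡⟨ cong (_* w) (∑-*ˡ xs v (λ x → ∑ ys (λ y → f (g x y)))) ⟨
      ∑ xs (λ x → v * ∑ ys (λ y → f (g x y))) * w
        ≡⟨ cong (_* w) (∑-cong xs (λ x → *-comm v _)) ⟩
      ∑ xs (λ x → ∑ ys (λ y → f (g x y)) * v) * w ∎
      where
      open ≡-Reasoning
      open +-*-Solver
      v = ℤ.+ 1 / length ys
      nz′ : NonZero (length xs ℕ.* length ys)
      nz′ = subst NonZero (length-product g xs ys) (ℕ.≢-nonZero (λ eq → ℕ.≢-nonZero⁻¹ _ {{nz}} eq))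

-- Over `allFin p` this is `𝔼ᵥ`, and over `all𝔽^ p n` it is the average over tuples of vectors, so
-- one set of lemmas serves both levels.
𝕍 : (xs : List A) .{{_ : NonZero (length xs)}} (n : ℕ) → (Vec A n → ℚ) → ℚ
𝕍 xs n = 𝔼 (vectors xs n) {{vectors-nonEmpty xs n}}

module _ (xs : List A) .{{_ : NonZero (length xs)}} where

  𝕍-zero : ∀ f → 𝕍 xs 0 f ≡ f []
  𝕍-zero f = trans (*-identityʳ _) (+-identityʳ (f []))

  𝕍-suc : ∀ n f → 𝕍 xs (suc n) f ≡ 𝔼 xs (λ x → 𝕍 xs n (λ v → f (x ∷ v)))
  𝕍-suc n f = 𝔼-product xs (vectors xs n) {{vectors-nonEmpty xs n}} _∷_ {{vectors-nonEmpty xs (suc n)}} f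

  𝕍-cong : ∀ n {f g : Vec A n → ℚ} → (∀ v → f v ≡ g v) → 𝕍 xs n f ≡ 𝕍 xs n g
  𝕍-cong n = 𝔼-cong (vectors xs n) {{vectors-nonEmpty xs n}}

  𝕍-+-split : ∀ m n f → 𝕍 xs (m ℕ.+ n) f ≡ 𝕍 xs m (λ u → 𝕍 xs n (λ v → f (u ++ v)))
  𝕍-+-split zero    n f = sym (𝕍-zero (λ u → 𝕍 xs n (λ v → f (u ++ v))))
  𝕍-+-split (suc m) n f = begin
    𝕍 xs (suc m ℕ.+ n) f
      ≡⟨ 𝕍-suc (m ℕ.+ n) f ⟩
    𝔼 xs (λ x → 𝕍 xs (m ℕ.+ n) (λ v → f (x ∷ v)))
      ≡⟨ 𝔼-cong xs (λ x → 𝕍-+-split m n (λ v → f (x ∷ v))) ⟩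
    𝔼 xs (λ x → 𝕍 xs m (λ u → 𝕍 xs n (λ v → f (x ∷ u ++ v))))
      ≡⟨ 𝕍-suc m _ ⟨
    𝕍 xs (suc m) (λ u → 𝕍 xs n (λ v → f (u ++ v))) ∎
    where open ≡-Reasoning

module _ (xs : List A) (ys : List B) (zs : List C)
         .{{_ : NonZero (length xs)}} .{{_ : NonZero (length ys)}} .{{_ : NonZero (length zs)}}
         (_⊕_ : A → B → C) (split : ∀ f → 𝔼 zs f ≡ 𝔼 xs (λ x → 𝔼 ys (λ y → f (x ⊕ y)))) where

  -- If a uniform entry is a combination of two independent uniform parts, then so is a uniform
  -- vector of entries. With `_++_` for `_⊕_`, a random tuple in the space of dimension k + k
  -- becomes a pair of independent tuples in dimension k.
  𝕍-zipWith-split : ∀ n f → 𝕍 zs n f ≡ 𝕍 xs n (λ u → 𝕍 ys n (λ v → f (zipWith _⊕_ u v)))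
  𝕍-zipWith-split zero    f = trans (𝕍-zero zs f) (sym (trans (𝕍-zero xs (λ u → 𝕍 ys 0 (λ v → f (zipWith _⊕_ u v)))) (𝕍-zero ys (λ v → f (zipWith _⊕_ [] v)))))
  𝕍-zipWith-split (suc n) f = begin
    𝕍 zs (suc n) f
      ≡⟨ 𝕍-suc zs n f ⟩
    𝔼 zs (λ z → 𝕍 zs n (λ w → f (z ∷ w)))
      ≡⟨ split _ ⟩
    𝔼 xs (λ x → 𝔼 ys (λ y → 𝕍 zs n (λ w → f (x ⊕ y ∷ w))))
      ≡⟨ 𝔼-cong xs (λ x → 𝔼-cong ys λ y → 𝕍-zipWith-split n (λ w → f (x ⊕ y ∷ w))) ⟩
    𝔼 xs (λ x → 𝔼 ys (λ y → 𝕍 xs n (λ u → 𝕍 ys n (λ v → f (x ⊕ y ∷ zipWith _⊕_ u v)))))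
      -- The head `y` of the second vector has to move past the tail `u` of the first before heads
      -- and tails can be reassembled.
      ≡⟨ 𝔼-cong xs (λ x → 𝔼-swap ys (vectors xs n) {{vectors-nonEmpty xs n}} (λ y u → 𝕍 ys n (λ v → f (x ⊕ y ∷ zipWith _⊕_ u v)))) ⟩
    𝔼 xs (λ x → 𝕍 xs n (λ u → 𝔼 ys (λ y → 𝕍 ys n (λ v → f (x ⊕ y ∷ zipWith _⊕_ u v)))))
      ≡⟨ 𝔼-cong xs (λ x → 𝕍-cong xs n λ u → 𝕍-suc ys n (λ v → f (zipWith _⊕_ (x ∷ u) v))) ⟨
    𝔼 xs (λ x → 𝕍 xs n (λ u → 𝕍 ys (suc n) (λ v → f (zipWith _⊕_ (x ∷ u) v))))
      ≡⟨ 𝕍-suc xs n _ ⟨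
    𝕍 xs (suc n) (λ u → 𝕍 ys (suc n) (λ v → f (zipWith _⊕_ u v))) ∎
    where open ≡-Reasoning

-- This is all that the fibre arguments use of a group structure on the domain, which may consist of
-- vectors or of tuples of vectors.
TranslationInvariant : (xs : List A) .{{_ : NonZero (length xs)}} → (A → A → A) → Set
TranslationInvariant {A = A} xs _⊕_ = ∀ t (f : A → ℚ) → 𝔼 xs (λ x → f (x ⊕ t)) ≡ 𝔼 xs f

𝕍-translation : (xs : List A) .{{_ : NonZero (length xs)}} (_⊕_ : A → A → A) → TranslationInvariant xs _⊕_ →
                ∀ n → TranslationInvariant (vectors xs n) {{vectors-nonEmpty xs n}} (zipWith _⊕_)
𝕍-translation xs _⊕_ inv zero    []      f = trans (𝕍-zero xs (λ v → f (zipWith _⊕_ v []))) (sym (𝕍-zero xs f))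
𝕍-translation xs _⊕_ inv (suc n) (s ∷ t) f = begin
  𝕍 xs (suc n) (λ v → f (zipWith _⊕_ v (s ∷ t)))          ≡⟨ 𝕍-suc xs n _ ⟩
  𝔼 xs (λ x → 𝕍 xs n (λ v → f (x ⊕ s ∷ zipWith _⊕_ v t))) ≡⟨ 𝔼-cong xs (λ x → 𝕍-translation xs _⊕_ inv n t (λ v → f (x ⊕ s ∷ v))) ⟩
  𝔼 xs (λ x → 𝕍 xs n (λ v → f (x ⊕ s ∷ v)))               ≡⟨ inv s (λ x → 𝕍 xs n (λ v → f (x ∷ v))) ⟩
  𝔼 xs (λ x → 𝕍 xs n (λ v → f (x ∷ v)))                   ≡⟨ 𝕍-suc xs n f ⟨
  𝕍 xs (suc n) f                                          ∎
  where open ≡-Reasoning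

-- The prime field and its uniform distribution

module _ {p : ℕ} .{{_ : NonZero p}} where

  1ₚ : 𝔽 p
  1ₚ = 1 mod p

  infix 8 -ₚ_
  -ₚ_ : 𝔽 p → 𝔽 p
  -ₚ x = (p ℕ.∸ toℕ x) mod p

  toℕ-of-mod : ∀ m → toℕ (m mod p) ≡ m % p
  toℕ-of-mod m = toℕ-fromℕ< (m%n<n m p)

  mod-cong : ∀ {m n} → m % p ≡ n % p → m mod p ≡ n mod p
  mod-cong {m} {n} eq = toℕ-injective (trans (toℕ-of-mod m) (trans eq (sym (toℕ-of-mod n))))

  toℕ-mod : ∀ x → toℕ x mod p ≡ x
  toℕ-mod x = toℕ-injective (trans (toℕ-of-mod (toℕ x)) (m<n⇒m%n≡m (toℕ<n x)))

  mod-+ : ∀ m n → (m mod p) +ₚ (n mod p) ≡ (m ℕ.+ n) mod p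
  mod-+ m n = mod-cong (trans (cong₂ (λ a b → (a ℕ.+ b) % p) (toℕ-of-mod m) (toℕ-of-mod n)) (sym (%-distribˡ-+ m n p)))

  mod-* : ∀ m n → (m mod p) *ₚ (n mod p) ≡ (m ℕ.* n) mod p
  mod-* m n = mod-cong (trans (cong₂ (λ a b → (a ℕ.* b) % p) (toℕ-of-mod m) (toℕ-of-mod n)) (sym (%-distribˡ-* m n p)))

  -- Strips the reduction from a compound right operand. The ring laws below follow from those of ℕ
  -- by first moving the compound term to the right.
  +ₚ-mod : ∀ x n → x +ₚ (n mod p) ≡ (toℕ x ℕ.+ n) mod p
  +ₚ-mod x n = trans (cong (_+ₚ (n mod p)) (sym (toℕ-mod x))) (mod-+ (toℕ x) n)

  *ₚ-mod : ∀ x n → x *ₚ (n mod p) ≡ (toℕ x ℕ.* n) mod p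
  *ₚ-mod x n = trans (cong (_*ₚ (n mod p)) (sym (toℕ-mod x))) (mod-* (toℕ x) n)

  +ₚ-comm : ∀ x y → x +ₚ y ≡ y +ₚ x
  +ₚ-comm x y = cong (_mod p) (ℕ.+-comm (toℕ x) (toℕ y))

  *ₚ-comm : ∀ x y → x *ₚ y ≡ y *ₚ x
  *ₚ-comm x y = cong (_mod p) (ℕ.*-comm (toℕ x) (toℕ y))

  +ₚ-assoc : ∀ x y z → (x +ₚ y) +ₚ z ≡ x +ₚ (y +ₚ z)
  +ₚ-assoc x y z = begin
    (x +ₚ y) +ₚ z                          ≡⟨ +ₚ-comm (x +ₚ y) z ⟩
    z +ₚ (x +ₚ y)                          ≡⟨ +ₚ-mod z _ ⟩
    (toℕ z ℕ.+ (toℕ x ℕ.+ toℕ y)) mod p    ≡⟨ cong (_mod p) (trans (ℕ.+-comm (toℕ z) _) (ℕ.+-assoc (toℕ x) (toℕ y) (toℕ z))) ⟩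
    (toℕ x ℕ.+ (toℕ y ℕ.+ toℕ z)) mod p    ≡⟨ +ₚ-mod x _ ⟨
    x +ₚ (y +ₚ z)                          ∎
    where open ≡-Reasoning

  *ₚ-assoc : ∀ x y z → (x *ₚ y) *ₚ z ≡ x *ₚ (y *ₚ z)
  *ₚ-assoc x y z = begin
    (x *ₚ y) *ₚ z                          ≡⟨ *ₚ-comm (x *ₚ y) z ⟩
    z *ₚ (x *ₚ y)                          ≡⟨ *ₚ-mod z _ ⟩
    (toℕ z ℕ.* (toℕ x ℕ.* toℕ y)) mod p    ≡⟨ cong (_mod p) (trans (ℕ.*-comm (toℕ z) _) (ℕ.*-assoc (toℕ x) (toℕ y) (toℕ z))) ⟩
    (toℕ x ℕ.* (toℕ y ℕ.* toℕ z)) mod p    ≡⟨ *ₚ-mod x _ ⟨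
    x *ₚ (y *ₚ z)                          ∎
    where open ≡-Reasoning

  +ₚ-identityˡ : ∀ x → 0ₚ +ₚ x ≡ x
  +ₚ-identityˡ x = trans (+ₚ-comm 0ₚ x) (trans (+ₚ-mod x 0) (trans (cong (_mod p) (ℕ.+-identityʳ (toℕ x))) (toℕ-mod x)))

  *ₚ-identityˡ : ∀ x → 1ₚ *ₚ x ≡ x
  *ₚ-identityˡ x = trans (*ₚ-comm 1ₚ x) (trans (*ₚ-mod x 1) (trans (cong (_mod p) (ℕ.*-identityʳ (toℕ x))) (toℕ-mod x)))

  *ₚ-zeroˡ : ∀ x → 0ₚ *ₚ x ≡ 0ₚ
  *ₚ-zeroˡ x = trans (*ₚ-comm 0ₚ x) (trans (*ₚ-mod x 0) (cong (_mod p) (ℕ.*-zeroʳ (toℕ x))))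

  *ₚ-distribʳ-+ₚ : ∀ x y z → (y +ₚ z) *ₚ x ≡ y *ₚ x +ₚ z *ₚ x
  *ₚ-distribʳ-+ₚ x y z = begin
    (y +ₚ z) *ₚ x                                  ≡⟨ *ₚ-comm (y +ₚ z) x ⟩
    x *ₚ (y +ₚ z)                                  ≡⟨ *ₚ-mod x _ ⟩
    (toℕ x ℕ.* (toℕ y ℕ.+ toℕ z)) mod p            ≡⟨ cong (_mod p) (trans (ℕ.*-comm (toℕ x) _) (ℕ.*-distribʳ-+ (toℕ x) (toℕ y) (toℕ z))) ⟩
    (toℕ y ℕ.* toℕ x ℕ.+ toℕ z ℕ.* toℕ x) mod p    ≡⟨ mod-+ _ _ ⟨
    y *ₚ x +ₚ z *ₚ x                               ∎
    where open ≡-Reasoning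

  +ₚ-inverseʳ : ∀ x → x +ₚ -ₚ x ≡ 0ₚ
  +ₚ-inverseʳ x = trans (+ₚ-mod x _) (mod-cong (trans (cong (_% p) (ℕ.m+[n∸m]≡n (ℕ.<⇒≤ (toℕ<n x)))) (trans (n%n≡0 p) (sym (m<n⇒m%n≡m (ℕ.>-nonZero⁻¹ p))))))

  private
    +ₚ-isCommutativeMonoid : IsCommutativeMonoid _≡_ _+ₚ_ 0ₚ
    +ₚ-isCommutativeMonoid = isCommutativeMonoidˡ record
      { isSemigroup = record { isMagma = record { isEquivalence = isEquivalence ; ∙-cong = cong₂ _+ₚ_ } ; assoc = +ₚ-assoc }
      ; identityˡ   = +ₚ-identityˡ
      ; comm        = +ₚ-comm
      }

    *ₚ-isCommutativeMonoid : IsCommutativeMonoid _≡_ _*ₚ_ 1ₚ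
    *ₚ-isCommutativeMonoid = isCommutativeMonoidˡ record
      { isSemigroup = record { isMagma = record { isEquivalence = isEquivalence ; ∙-cong = cong₂ _*ₚ_ } ; assoc = *ₚ-assoc }
      ; identityˡ   = *ₚ-identityˡ
      ; comm        = *ₚ-comm
      }

  𝔽-commutativeSemiring : CommutativeSemiring 0ℓ 0ℓ
  𝔽-commutativeSemiring = record
    { isCommutativeSemiring = isCommutativeSemiringˡ record
      { +-isCommutativeMonoid = +ₚ-isCommutativeMonoid
      ; *-isCommutativeMonoid = *ₚ-isCommutativeMonoid
      ; distribʳ              = *ₚ-distribʳ-+ₚ
      ; zeroˡ                 = *ₚ-zeroˡ
      }
    }

  open CommutativeSemiring 𝔽-commutativeSemiring public
    using () renaming (+-identityʳ to +ₚ-identityʳ; *-identityʳ to *ₚ-identityʳ; zeroʳ to *ₚ-zeroʳ; distribˡ to *ₚ-distribˡ-+ₚ)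

  +ₚ-cancel : ∀ x y → (x +ₚ y) +ₚ -ₚ y ≡ x
  +ₚ-cancel x y = trans (+ₚ-assoc x y (-ₚ y)) (trans (cong (x +ₚ_) (+ₚ-inverseʳ y)) (+ₚ-identityʳ x))

  -ₚ-cancel : ∀ x y → (x +ₚ -ₚ y) +ₚ y ≡ x
  -ₚ-cancel x y = trans (+ₚ-assoc x (-ₚ y) y) (trans (cong (x +ₚ_) (trans (+ₚ-comm (-ₚ y) y) (+ₚ-inverseʳ y))) (+ₚ-identityʳ x))

  +ₚ-cancelʳ : ∀ {x y} z → x +ₚ z ≡ y +ₚ z → x ≡ y
  +ₚ-cancelʳ {x} {y} z eq = trans (sym (+ₚ-cancel x z)) (trans (cong (_+ₚ -ₚ z) eq) (+ₚ-cancel y z))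

  -- Bézout for the coprime numbers p and x gives 1 + y x = k p or 1 + k p = y x. Modulo p the
  -- inverse is then -y or y respectively.
  inverse : Prime p → ∀ x → x ≢ 0ₚ → ∃[ y ] x *ₚ y ≡ 1ₚ
  inverse p-prime x x≢0 = helper (coprime-Bézout (prime⇒coprime p-prime {{x≢0′}} (toℕ<n x)))
    where
    open ≡-Reasoning
    x≢0′ : NonZero (toℕ x)
    x≢0′ = ℕ.≢-nonZero (λ eq → x≢0 (trans (sym (toℕ-mod x)) (cong (_mod p) eq)))
    kp≡0 : ∀ k → (k ℕ.* p) mod p ≡ 0ₚ
    kp≡0 k = mod-cong (trans (m*n%n≡0 k p) (sym (m<n⇒m%n≡m (ℕ.>-nonZero⁻¹ p))))
    yx : ∀ y → (y ℕ.* toℕ x) mod p ≡ x *ₚ (y mod p)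
    yx y = trans (cong (_mod p) (ℕ.*-comm y (toℕ x))) (sym (*ₚ-mod x y))
    helper : Bézout.Identity 1 p (toℕ x) → ∃[ y ] x *ₚ y ≡ 1ₚ
    helper (Bézout.+- k y eq) = -ₚ (y mod p) , +ₚ-cancelʳ (x *ₚ (y mod p)) (begin
      x *ₚ -ₚ (y mod p) +ₚ x *ₚ (y mod p)      ≡⟨ *ₚ-distribˡ-+ₚ x _ _ ⟨
      x *ₚ (-ₚ (y mod p) +ₚ (y mod p))         ≡⟨ cong (x *ₚ_) (trans (+ₚ-comm _ (y mod p)) (+ₚ-inverseʳ (y mod p))) ⟩
      x *ₚ 0ₚ                                  ≡⟨ *ₚ-zeroʳ x ⟩
      0ₚ                                       ≡⟨ kp≡0 k ⟨
      (k ℕ.* p) mod p                          ≡⟨ cong (_mod p) eq ⟨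
      (1 ℕ.+ y ℕ.* toℕ x) mod p                ≡⟨ mod-+ 1 (y ℕ.* toℕ x) ⟨
      1ₚ +ₚ ((y ℕ.* toℕ x) mod p)              ≡⟨ cong (1ₚ +ₚ_) (yx y) ⟩
      1ₚ +ₚ x *ₚ (y mod p)                     ∎)
    helper (Bézout.-+ k y eq) = y mod p , (begin
      x *ₚ (y mod p)                           ≡⟨ yx y ⟨
      (y ℕ.* toℕ x) mod p                      ≡⟨ cong (_mod p) eq ⟨
      (1 ℕ.+ k ℕ.* p) mod p                    ≡⟨ mod-+ 1 (k ℕ.* p) ⟨
      1ₚ +ₚ ((k ℕ.* p) mod p)                  ≡⟨ cong (1ₚ +ₚ_) (kp≡0 k) ⟩
      1ₚ +ₚ 0ₚ                                 ≡⟨ +ₚ-identityʳ 1ₚ ⟩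
      1ₚ                                       ∎)

∑-tabulate : ∀ {A : Set} {n} (g : Fin n → A) (f : A → ℚ) → ∑ (tabulateˡ g) f ≡ sumℚ (λ i → f (g i))
∑-tabulate {n = zero}  g f = refl
∑-tabulate {n = suc n} g f = cong (f (g zero) +_) (∑-tabulate (λ i → g (suc i)) f)

∑-point : ∀ {n} (x : Fin n) → sumℚ (λ y → ind (x ≟ᶠ y)) ≡ 1ℚ
∑-point {suc n} zero    = trans (cong (1ℚ +_) (CommutativeMonoidSum.sum-replicate-zero +-0-commutativeMonoid n)) (+-identityʳ 1ℚ)
∑-point {suc n} (suc x) = trans (+-identityˡ _) (trans (CommutativeMonoidSum.sum-cong-≗ +-0-commutativeMonoid
  (λ y → ind-cong (suc x ≟ᶠ suc y) (x ≟ᶠ y) suc-injective (cong suc))) (∑-point x))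

module _ (p : ℕ) .{{_ : NonZero p}} where

  allFin-nonEmpty : NonZero (length (allFin p))
  allFin-nonEmpty = subst NonZero (sym (length-tabulate {n = p} (λ i → i))) (ℕ.≢-nonZero (ℕ.≢-nonZero⁻¹ p))

  ρ : ℚ
  ρ = ℤ.+ 1 / p

  𝔼-point : ∀ x → 𝔼 (allFin p) {{allFin-nonEmpty}} (λ y → ind (x ≟ᶠ y)) ≡ ρ
  𝔼-point x = trans (cong₂ _*_ (trans (∑-tabulate {n = p} (λ i → i) (λ y → ind (x ≟ᶠ y))) (∑-point x))
      (/-cong {ℤ.+ 1} {length (allFin p)} {ℤ.+ 1} {p} {{allFin-nonEmpty}} refl (length-tabulate {n = p} (λ i → i))))
    (*-identityˡ ρ)

  𝔼-translation : TranslationInvariant (allFin p) {{allFin-nonEmpty}} _+ₚ_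
  𝔼-translation t f = cong (_* (ℤ.+ 1 / length (allFin p)) {{allFin-nonEmpty}}) (begin
    ∑ (allFin p) (λ x → f (x +ₚ t))    ≡⟨ ∑-tabulate {n = p} (λ i → i) (λ x → f (x +ₚ t)) ⟩
    sumℚ (λ x → f (x +ₚ t))            ≡⟨ CommutativeMonoidSum.sum-permute +-0-commutativeMonoid f
                                            (permutation (_+ₚ t) (_+ₚ -ₚ t) (λ x → -ₚ-cancel x t) (λ x → +ₚ-cancel x t)) ⟨
    sumℚ f                             ≡⟨ ∑-tabulate {n = p} (λ i → i) f ⟨
    ∑ (allFin p) f                     ∎)
    where open ≡-Reasoning

-- Linear algebra over 𝔽_p and fibres of additive maps

module _ {p : ℕ} .{{_ : NonZero p}} where

  open CommutativeSemiring (𝔽-commutativeSemiring {p})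
    using (semiring; +-commutativeMonoid; +-commutativeSemigroup; *-commutativeSemigroup)
  open CommutativeMonoidSum +-commutativeMonoid using (∑-comm; sum-cong-≗; sum-replicate-zero)
  open SemiringSum semiring using (*-distribˡ-sum; *-distribʳ-sum)

  +ₚ-interchange : ∀ (w x y z : 𝔽 p) → (w +ₚ x) +ₚ (y +ₚ z) ≡ (w +ₚ y) +ₚ (x +ₚ z)
  +ₚ-interchange = interchange +-commutativeSemigroup

  +ᵥ-interchange : ∀ (t u v w : 𝔽^ p n) → (t +ᵥ u) +ᵥ (v +ᵥ w) ≡ (t +ᵥ v) +ᵥ (u +ᵥ w)
  +ᵥ-interchange []      []      []      []      = refl
  +ᵥ-interchange (a ∷ t) (b ∷ u) (c ∷ v) (d ∷ w) = cong₂ _∷_ (+ₚ-interchange a b c d) (+ᵥ-interchange t u v w)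

  +ᵥ-identityˡ : ∀ (v : 𝔽^ p n) → 0ᵥ +ᵥ v ≡ v
  +ᵥ-identityˡ []      = refl
  +ᵥ-identityˡ (x ∷ v) = cong₂ _∷_ (+ₚ-identityˡ x) (+ᵥ-identityˡ v)

  +ᵥ-cancelʳ : ∀ {u v : 𝔽^ p n} w → u +ᵥ w ≡ v +ᵥ w → u ≡ v
  +ᵥ-cancelʳ {u = []}    {[]}    []      _  = refl
  +ᵥ-cancelʳ {u = x ∷ u} {y ∷ v} (z ∷ w) eq =
    cong₂ _∷_ (+ₚ-cancelʳ z (proj₁ (∷-injective eq))) (+ᵥ-cancelʳ w (proj₂ (∷-injective eq)))

  ·ᵥ-distribˡ-+ᵥ : ∀ c (u v : 𝔽^ p n) → c ·ᵥ (u +ᵥ v) ≡ c ·ᵥ u +ᵥ c ·ᵥ v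
  ·ᵥ-distribˡ-+ᵥ c []      []      = refl
  ·ᵥ-distribˡ-+ᵥ c (x ∷ u) (y ∷ v) = cong₂ _∷_ (*ₚ-distribˡ-+ₚ c x y) (·ᵥ-distribˡ-+ᵥ c u v)

  eval-+ : ∀ (γ : LinearForm p d) (x y : Vec (𝔽^ p n) d) →
           eval γ (zipWith _+ᵥ_ x y) ≡ eval γ x +ᵥ eval γ y
  eval-+ γ []      []      = sym (+ᵥ-identityˡ 0ᵥ)
  eval-+ γ (u ∷ x) (v ∷ y) = trans
    (cong₂ _+ᵥ_ (·ᵥ-distribˡ-+ᵥ (γ zero) u v) (eval-+ (λ r → γ (suc r)) x y))
    (+ᵥ-interchange (γ zero ·ᵥ u) (γ zero ·ᵥ v) _ _)

  eval-++ : ∀ (γ : LinearForm p d) (x : Vec (𝔽^ p m) d) (y : Vec (𝔽^ p n) d) →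
            eval γ (zipWith _++_ x y) ≡ eval γ x ++ eval γ y
  eval-++ {m = m} {n = n} γ [] [] = 0ᵥ-++ m
    where
    0ᵥ-++ : ∀ m → 0ᵥ {n = m ℕ.+ n} ≡ 0ᵥ {n = m} ++ 0ᵥ
    0ᵥ-++ zero    = refl
    0ᵥ-++ (suc m) = cong (0ₚ ∷_) (0ᵥ-++ m)
  eval-++ γ (u ∷ x) (v ∷ y) = trans
    (cong₂ _+ᵥ_ (map-++ (γ zero *ₚ_) u v) (eval-++ (λ r → γ (suc r)) x y))
    (zipWith-++ _+ₚ_ (γ zero ·ᵥ u) (γ zero ·ᵥ v) _ _)

  dot : 𝔽^ p n → 𝔽^ p n → 𝔽 p
  dot []      []      = 0ₚ
  dot (x ∷ u) (y ∷ v) = x *ₚ y +ₚ dot u v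

  dot-comm : ∀ (u v : 𝔽^ p n) → dot u v ≡ dot v u
  dot-comm []      []      = refl
  dot-comm (x ∷ u) (y ∷ v) = cong₂ _+ₚ_ (*ₚ-comm x y) (dot-comm u v)

  dot-+ʳ : ∀ (u v w : 𝔽^ p n) → dot u (v +ᵥ w) ≡ dot u v +ₚ dot u w
  dot-+ʳ []      []      []      = sym (+ₚ-identityˡ 0ₚ)
  dot-+ʳ (x ∷ u) (y ∷ v) (z ∷ w) = trans (cong₂ _+ₚ_ (*ₚ-distribˡ-+ₚ x y z) (dot-+ʳ u v w))
    (+ₚ-interchange (x *ₚ y) (x *ₚ z) (dot u v) (dot u w))

  dot-·ʳ : ∀ c (u v : 𝔽^ p n) → dot u (c ·ᵥ v) ≡ c *ₚ dot u v
  dot-·ʳ c []      []      = sym (*ₚ-zeroʳ c)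
  dot-·ʳ c (x ∷ u) (y ∷ v) = trans
    (cong₂ _+ₚ_ (x∙yz≈y∙xz *-commutativeSemigroup x c y) (dot-·ʳ c u v))
    (sym (*ₚ-distribˡ-+ₚ c (x *ₚ y) (dot u v)))

  dot-0ʳ : ∀ (u : 𝔽^ p n) → dot u 0ᵥ ≡ 0ₚ
  dot-0ʳ []      = refl
  dot-0ʳ (x ∷ u) = trans (cong₂ _+ₚ_ (*ₚ-zeroʳ x) (dot-0ʳ u)) (+ₚ-identityˡ 0ₚ)

  dot-evalʳ : ∀ (γ : LinearForm p d) (u : 𝔽^ p n) (y : Vec (𝔽^ p n) d) →
              dot u (eval γ y) ≡ sumₚ (λ s → γ s *ₚ dot u (lookup y s))
  dot-evalʳ γ u []      = dot-0ʳ u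
  dot-evalʳ γ u (v ∷ y) = trans (dot-+ʳ u (γ zero ·ᵥ v) _)
    (cong₂ _+ₚ_ (dot-·ʳ (γ zero) u v) (dot-evalʳ (λ s → γ (suc s)) u y))

  -- By bilinearity L(x) · L(y) depends on the coefficients of L only through the products γᵣ γₛ.
  -- This is where the matrices of the hypothesis enter.
  dot-eval-eval : ∀ (γ : LinearForm p d) (x y : Vec (𝔽^ p n) d) →
                  dot (eval γ x) (eval γ y) ≡ sumₚ (λ r → sumₚ (λ s → Γ γ r s *ₚ dot (lookup x r) (lookup y s)))
  dot-eval-eval {d = d} γ x y = begin
    dot (eval γ x) (eval γ y)
      ≡⟨ dot-comm (eval γ x) (eval γ y) ⟩
    dot (eval γ y) (eval γ x)
      ≡⟨ dot-evalʳ γ (eval γ y) x ⟩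
    sumₚ (λ r → γ r *ₚ dot (eval γ y) (lookup x r))
      ≡⟨ sum-cong-≗ {d} (λ r → cong (γ r *ₚ_) (trans (dot-comm (eval γ y) (lookup x r)) (dot-evalʳ γ (lookup x r) y))) ⟩
    sumₚ (λ r → γ r *ₚ sumₚ (λ s → γ s *ₚ dot (lookup x r) (lookup y s)))
      ≡⟨ sum-cong-≗ {d} (λ r → *-distribˡ-sum {d} (γ r) (λ s → γ s *ₚ dot (lookup x r) (lookup y s))) ⟩
    sumₚ (λ r → sumₚ (λ s → γ r *ₚ (γ s *ₚ dot (lookup x r) (lookup y s))))
      ≡⟨ sum-cong-≗ {d} (λ r → sum-cong-≗ {d} (λ s → *ₚ-assoc (γ r) (γ s) _)) ⟨
    sumₚ (λ r → sumₚ (λ s → Γ γ r s *ₚ dot (lookup x r) (lookup y s))) ∎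
    where open ≡-Reasoning

  -- Once the sum over i is innermost, the coefficient of xᵣ · yₛ is the (r , s) entry of the
  -- vanishing combination of the matrices. So c is orthogonal to every vector of values Lᵢ(x) ·
  -- Lᵢ(y).
  dependence⇒relation : ∀ (L : Fin m → LinearForm p d) (c : Fin m → 𝔽 p) →
    (∀ r s → sumₚ (λ i → c i *ₚ Γ (L i) r s) ≡ 0ₚ) →
    ∀ (x y : Vec (𝔽^ p n) d) → sumₚ (λ i → c i *ₚ dot (eval (L i) x) (eval (L i) y)) ≡ 0ₚ
  dependence⇒relation {m = m} {d = d} L c dep x y = begin
    sumₚ (λ i → c i *ₚ dot (eval (L i) x) (eval (L i) y))
      ≡⟨ sum-cong-≗ {m} (λ i → trans (cong (c i *ₚ_) (dot-eval-eval (L i) x y)) (expand i)) ⟩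
    sumₚ (λ i → sumₚ (λ r → sumₚ (λ s → (c i *ₚ Γ (L i) r s) *ₚ D r s)))
      ≡⟨ ∑-comm {m} {d} (λ i r → sumₚ (λ s → (c i *ₚ Γ (L i) r s) *ₚ D r s)) ⟩
    sumₚ (λ r → sumₚ (λ i → sumₚ (λ s → (c i *ₚ Γ (L i) r s) *ₚ D r s)))
      ≡⟨ sum-cong-≗ {d} (λ r → ∑-comm {m} {d} (λ i s → (c i *ₚ Γ (L i) r s) *ₚ D r s)) ⟩
    sumₚ (λ r → sumₚ (λ s → sumₚ (λ i → (c i *ₚ Γ (L i) r s) *ₚ D r s)))
      ≡⟨ sum-cong-≗ {d} (λ r → trans (sum-cong-≗ {d} (vanish r)) (sum-replicate-zero d)) ⟩
    sumₚ {m = d} (λ _ → 0ₚ)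
      ≡⟨ sum-replicate-zero d ⟩
    0ₚ ∎
    where
    open ≡-Reasoning
    D : Fin d → Fin d → 𝔽 p
    D r s = dot (lookup x r) (lookup y s)
    expand : ∀ i → c i *ₚ sumₚ (λ r → sumₚ (λ s → Γ (L i) r s *ₚ D r s)) ≡
                   sumₚ (λ r → sumₚ (λ s → (c i *ₚ Γ (L i) r s) *ₚ D r s))
    expand i = trans (*-distribˡ-sum {d} (c i) (λ r → sumₚ (λ s → Γ (L i) r s *ₚ D r s)))
      (sum-cong-≗ {d} (λ r → trans (*-distribˡ-sum {d} (c i) (λ s → Γ (L i) r s *ₚ D r s))
        (sum-cong-≗ {d} (λ s → sym (*ₚ-assoc (c i) (Γ (L i) r s) (D r s))))))
    vanish : ∀ r s → sumₚ (λ i → (c i *ₚ Γ (L i) r s) *ₚ D r s) ≡ 0ₚ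
    vanish r s = trans (sym (*-distribʳ-sum {m} (D r s) (λ i → c i *ₚ Γ (L i) r s)))
      (trans (cong (_*ₚ D r s) (dep r s)) (*ₚ-zeroˡ (D r s)))

  dot-tabulate : ∀ (c f : Fin m → 𝔽 p) → dot (tabulate c) (tabulate f) ≡ sumₚ (λ i → c i *ₚ f i)
  dot-tabulate {m = zero}  c f = refl
  dot-tabulate {m = suc m} c f = cong (c zero *ₚ f zero +ₚ_) (dot-tabulate (λ i → c (suc i)) (λ i → f (suc i)))

  tabulate-+ : ∀ (f g : Fin m → 𝔽 p) → tabulate (λ i → f i +ₚ g i) ≡ tabulate f +ᵥ tabulate g
  tabulate-+ {m = zero}  f g = refl
  tabulate-+ {m = suc m} f g = cong (f zero +ₚ g zero ∷_) (tabulate-+ (λ i → f (suc i)) (λ i → g (suc i)))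

  basis : Fin n → 𝔽^ p n
  basis zero    = 1ₚ ∷ 0ᵥ
  basis (suc i) = 0ₚ ∷ basis i

  dot-basis : ∀ (u : 𝔽^ p n) i → dot u (basis i) ≡ lookup u i
  dot-basis (x ∷ u) zero    = trans (cong₂ _+ₚ_ (*ₚ-identityʳ x) (dot-0ʳ u)) (+ₚ-identityʳ x)
  dot-basis (x ∷ u) (suc i) = trans (cong₂ _+ₚ_ (*ₚ-zeroʳ x) (dot-basis u i)) (+ₚ-identityˡ _)

  -- A nonzero coordinate is invertible because p is prime, so multiples of a single basis vector
  -- already attain every value.
  dot-surjective : Prime p → ∀ (c : 𝔽^ p n) i → lookup c i ≢ 0ₚ → ∀ y → ∃[ x ] dot c x ≡ y
  dot-surjective p-prime c i cᵢ≢0 y with inverse p-prime (lookup c i) cᵢ≢0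
  ... | z , cᵢz≡1 = (y *ₚ z) ·ᵥ basis i , (begin
    dot c ((y *ₚ z) ·ᵥ basis i)    ≡⟨ dot-·ʳ (y *ₚ z) c (basis i) ⟩
    y *ₚ z *ₚ dot c (basis i)      ≡⟨ cong (y *ₚ z *ₚ_) (dot-basis c i) ⟩
    y *ₚ z *ₚ lookup c i           ≡⟨ *ₚ-assoc y z (lookup c i) ⟩
    y *ₚ (z *ₚ lookup c i)         ≡⟨ cong (y *ₚ_) (trans (*ₚ-comm z (lookup c i)) cᵢz≡1) ⟩
    y *ₚ 1ₚ                        ≡⟨ *ₚ-identityʳ y ⟩
    y                              ∎)
    where open ≡-Reasoning

infix 4 _≟ᵥ_
_≟ᵥ_ : DecidableEquality (𝔽^ p n)
_≟ᵥ_ = ≡-dec _≟ᶠ_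

module _ {p : ℕ} .{{_ : NonZero p}} where

  private instance
    allFin≢0 : NonZero (length (allFin p))
    allFin≢0 = allFin-nonEmpty p

  𝔼ᵥ-point : ∀ (x : 𝔽^ p n) → 𝔼ᵥ (λ y → ind (x ≟ᵥ y)) ≡ ρ p ^ n
  𝔼ᵥ-point []                  = 𝕍-zero (allFin p) (λ y → ind ([] ≟ᵥ y))
  𝔼ᵥ-point {n = suc n} (x ∷ v) = begin
    𝔼ᵥ (λ y → ind (x ∷ v ≟ᵥ y))
      ≡⟨ 𝕍-suc (allFin p) n (λ y → ind (x ∷ v ≟ᵥ y)) ⟩
    𝔼 (allFin p) (λ y → 𝔼ᵥ (λ w → ind (x ∷ v ≟ᵥ y ∷ w)))
      ≡⟨ 𝔼-cong (allFin p) (λ y → 𝕍-cong (allFin p) n (λ w → ind-× (x ≟ᶠ y) (v ≟ᵥ w) (x ∷ v ≟ᵥ y ∷ w) ∷-injective (cong₂ _∷_))) ⟩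
    𝔼 (allFin p) (λ y → 𝔼ᵥ (λ w → ind (x ≟ᶠ y) * ind (v ≟ᵥ w)))
      ≡⟨ 𝔼-cong (allFin p) (λ y → trans (𝔼-*ˡ (all𝔽^ p n) {{all𝔽^-nonEmpty p n}} (ind (x ≟ᶠ y)) (λ w → ind (v ≟ᵥ w))) (cong (ind (x ≟ᶠ y) *_) (𝔼ᵥ-point v))) ⟩
    𝔼 (allFin p) (λ y → ind (x ≟ᶠ y) * ρ p ^ n)
      ≡⟨ 𝔼-*ʳ (allFin p) (ρ p ^ n) (λ y → ind (x ≟ᶠ y)) ⟩
    𝔼 (allFin p) (λ y → ind (x ≟ᶠ y)) * ρ p ^ n
      ≡⟨ cong (_* ρ p ^ n) (𝔼-point p x) ⟩
    ρ p ^ suc n ∎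
    where open ≡-Reasoning

  𝔼ᵥ-translation : ∀ n → TranslationInvariant (all𝔽^ p n) {{all𝔽^-nonEmpty p n}} _+ᵥ_
  𝔼ᵥ-translation = 𝕍-translation (allFin p) _+ₚ_ (𝔼-translation p)

  -- The probability that an additive map takes a given value is, by
  -- translation, that of its kernel on the image and 0 outside.
  module Fibre {n} {X : Set} (xs : List X) .{{xs≢[] : NonZero (length xs)}}
               (_⊕_ : X → X → X) (inv : TranslationInvariant xs _⊕_)
               (φ : X → 𝔽^ p n) (φ-+ : ∀ x y → φ (x ⊕ y) ≡ φ x +ᵥ φ y) where

    fibre : 𝔽^ p n → ℚ
    fibre y = 𝔼 xs (λ x → ind (φ x ≟ᵥ y))

    kernel : ℚ
    kernel = fibre 0ᵥ

    fibre-image : ∀ x₀ → fibre (φ x₀) ≡ kernel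
    fibre-image x₀ = trans (sym (inv x₀ (λ x → ind (φ x ≟ᵥ φ x₀))))
      (𝔼-cong xs (λ x → ind-cong (φ (x ⊕ x₀) ≟ᵥ φ x₀) (φ x ≟ᵥ 0ᵥ)
        (λ eq → +ᵥ-cancelʳ (φ x₀) (trans (sym (φ-+ x x₀)) (trans eq (sym (+ᵥ-identityˡ (φ x₀))))))
        (λ eq → trans (φ-+ x x₀) (trans (cong (_+ᵥ φ x₀) eq) (+ᵥ-identityˡ (φ x₀))))))

    -- Handles an affine condition: a constant in the image is absorbed by translating the domain.
    shifted-kernel : ∀ x₀ → 𝔼 xs (λ x → ind (φ x +ᵥ φ x₀ ≟ᵥ 0ᵥ)) ≡ kernel
    shifted-kernel x₀ = trans (𝔼-cong xs (λ x → cong (λ y → ind (y ≟ᵥ 0ᵥ)) (sym (φ-+ x x₀))))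
      (inv x₀ (λ x → ind (φ x ≟ᵥ 0ᵥ)))

    0≤kernel : 0ℚ ≤ kernel
    0≤kernel = subst (_≤ kernel) (𝔼-const xs 0ℚ) (𝔼-mono xs (λ x → 0≤ind (φ x ≟ᵥ 0ᵥ)))

    fibre≤kernel : ∀ y → fibre y ≤ kernel
    fibre≤kernel y with 𝔼-vanishes-or-witness xs (λ x → φ x ≟ᵥ y)
    ... | inj₁ eq         = subst (_≤ kernel) (sym eq) 0≤kernel
    ... | inj₂ (x₀ , refl) = ≤-reflexive (fibre-image x₀)

    -- Double counting: each x lies over exactly one y. Together with `fibre≤kernel` this replaces
    -- rank and nullity: the kernel has density at least ρ^n, with equality when all fibres are
    -- alike.
    𝔼-fibre : 𝔼ᵥ fibre ≡ ρ p ^ n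
    𝔼-fibre = begin
      𝔼ᵥ (λ y → 𝔼 xs (λ x → ind (φ x ≟ᵥ y)))   ≡⟨ 𝔼-swap (all𝔽^ p n) {{all𝔽^-nonEmpty p n}} xs (λ y x → ind (φ x ≟ᵥ y)) ⟩
      𝔼 xs (λ x → 𝔼ᵥ (λ y → ind (φ x ≟ᵥ y)))   ≡⟨ 𝔼-cong xs (λ x → 𝔼ᵥ-point (φ x)) ⟩
      𝔼 xs (λ x → ρ p ^ n)                     ≡⟨ 𝔼-const xs (ρ p ^ n) ⟩
      ρ p ^ n                                  ∎
      where open ≡-Reasoning

    kernel-lowerBound : ρ p ^ n ≤ kernel
    kernel-lowerBound = subst₂ _≤_ 𝔼-fibre (𝔼-const (all𝔽^ p n) {{all𝔽^-nonEmpty p n}} kernel)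
      (𝔼-mono (all𝔽^ p n) {{all𝔽^-nonEmpty p n}} fibre≤kernel)

    kernel-surjective : (∀ y → ∃[ x ] φ x ≡ y) → kernel ≡ ρ p ^ n
    kernel-surjective surj = begin
      kernel              ≡⟨ 𝔼-const (all𝔽^ p n) {{all𝔽^-nonEmpty p n}} kernel ⟨
      𝔼ᵥ {p = p} {n = n} (λ _ → kernel)   ≡⟨ 𝕍-cong (allFin p) n (λ y → let x₀ , eq = surj y in trans (sym (fibre-image x₀)) (cong fibre eq)) ⟩
      𝔼ᵥ fibre            ≡⟨ 𝔼-fibre ⟩
      ρ p ^ n             ∎
      where open ≡-Reasoning

  -- The functional u · v is wrapped as a map into dimension 1 so that the results on fibres apply;
  -- the lemmas below remove the wrapping and the factor 1 in ρ^1.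
  module Dot {n} (u : 𝔽^ p n) = Fibre (all𝔽^ p n) {{all𝔽^-nonEmpty p n}} _+ᵥ_ (𝔼ᵥ-translation n)
    (λ v → dot u v ∷ []) (λ v w → cong (_∷ []) (dot-+ʳ u v w))

  dot-kernel : ∀ (u : 𝔽^ p n) → 𝔼ᵥ (λ v → ind (dot u v ≟ᶠ 0ₚ)) ≡ Dot.kernel u
  dot-kernel {n = n} u = 𝕍-cong (allFin p) n (λ v → ind-cong (dot u v ≟ᶠ 0ₚ) (dot u v ∷ [] ≟ᵥ 0ᵥ) (cong (_∷ [])) (λ eq → proj₁ (∷-injective eq)))

  ρ≤dot-kernel : ∀ (u : 𝔽^ p n) → ρ p ≤ 𝔼ᵥ (λ v → ind (dot u v ≟ᶠ 0ₚ))
  ρ≤dot-kernel u = subst₂ _≤_ (*-identityʳ (ρ p)) (sym (dot-kernel u)) (Dot.kernel-lowerBound u)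

  dot-kernel-surjective : ∀ (u : 𝔽^ p n) → (∀ y → ∃[ v ] dot u v ≡ y) → 𝔼ᵥ (λ v → ind (dot u v ≟ᶠ 0ₚ)) ≡ ρ p
  dot-kernel-surjective u surj = trans (dot-kernel u) (trans (Dot.kernel-surjective u
    (λ { (y ∷ []) → let v , eq = surj y in v , cong (_∷ []) eq })) (*-identityʳ (ρ p)))

  module _ {n} {X : Set} (xs : List X) .{{xs≢[] : NonZero (length xs)}}
           (_⊕_ : X → X → X) (inv : TranslationInvariant xs _⊕_)
           (φ : X → 𝔽^ p n) (φ-+ : ∀ x y → φ (x ⊕ y) ≡ φ x +ᵥ φ y) where

    open Fibre xs _⊕_ inv φ φ-+

    -- The fibres average to ρ^n but are empty off the hyperplane c · y = 0, which has density ρ. On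
    -- the hyperplane none exceeds the kernel, which must therefore make up for the missing factor
    -- p.
    kernel-of-map-into-hyperplane : (c : 𝔽^ p n) → (∀ y → ∃[ v ] dot c v ≡ y) → (∀ x → dot c (φ x) ≡ 0ₚ) →
                                    ρ p ^ n ≤ ρ p * kernel
    kernel-of-map-into-hyperplane c c-surj cφ≡0 = begin
      ρ p ^ n                                       ≡⟨ 𝔼-fibre ⟨
      𝔼ᵥ fibre                                      ≤⟨ 𝔼-mono (all𝔽^ p n) {{all𝔽^-nonEmpty p n}} bound ⟩
      𝔼ᵥ (λ y → ind (dot c y ≟ᶠ 0ₚ) * kernel)       ≡⟨ 𝔼-*ʳ (all𝔽^ p n) {{all𝔽^-nonEmpty p n}} kernel (λ y → ind (dot c y ≟ᶠ 0ₚ)) ⟩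
      𝔼ᵥ (λ y → ind (dot c y ≟ᶠ 0ₚ)) * kernel       ≡⟨ cong (_* kernel) (dot-kernel-surjective c c-surj) ⟩
      ρ p * kernel                                  ∎
      where
      open ≤-Reasoning
      bound : ∀ y → fibre y ≤ ind (dot c y ≟ᶠ 0ₚ) * kernel
      bound y with dot c y ≟ᶠ 0ₚ
      ... | yes _    = subst (fibre y ≤_) (sym (*-identityˡ kernel)) (fibre≤kernel y)
      ... | no cy≢0 = ≤-reflexive (trans
        (trans (𝔼-cong xs (λ x → ind-false (φ x ≟ᵥ y) (λ eq → cy≢0 (trans (cong (dot c) (sym eq)) (cφ≡0 x))))) (𝔼-const xs 0ℚ))
        (sym (*-zeroˡ kernel)))

-- Correlations, the U² norm, and isotropic pairs

module _ (xs : List A) .{{_ : NonZero (length xs)}} where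

  𝔼-affine : ∀ b c (f : A → ℚ) → 𝔼 xs (λ x → b + c * f x) ≡ b + c * 𝔼 xs f
  𝔼-affine b c f = trans (𝔼-+ xs (λ _ → b) (λ x → c * f x)) (cong₂ _+_ (𝔼-const xs b) (𝔼-*ˡ xs c f))

  𝔼-upper : ∀ {f : A → ℚ} {c} → (∀ x → f x ≤ c) → 𝔼 xs f ≤ c
  𝔼-upper {c = c} f≤c = subst (_ ≤_) (𝔼-const xs c) (𝔼-mono xs f≤c)

  𝔼-lower : ∀ {f : A → ℚ} {c} → (∀ x → c ≤ f x) → c ≤ 𝔼 xs f
  𝔼-lower {c = c} c≤f = subst (_≤ _) (𝔼-const xs c) (𝔼-mono xs c≤f)

-- Keeps the error linear in y, by spending x ≤ 1 on one factor, so that afterwards only the mean of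
-- the error matters.
square-bound : ∀ {x r y} → 0ℚ ≤ x → x ≤ 1ℚ → 0ℚ ≤ r → r ≤ 1ℚ → 0ℚ ≤ y → x ≤ r + y → x * x ≤ r * r + (y + y)
square-bound {x} {r} {y} 0≤x x≤1 0≤r r≤1 0≤y x≤r+y = begin
  x * x                        ≤⟨ *-monoˡ 0≤x x≤r+y ⟩
  x * (r + y)                  ≡⟨ *-distribˡ-+ x r y ⟩
  x * r + x * y                ≤⟨ +-mono-≤ (*-monoʳ 0≤r x≤r+y) (*-monoʳ 0≤y x≤1) ⟩
  (r + y) * r + 1ℚ * y         ≡⟨ solve 2 (λ r y → (r :+ y) :* r :+ con 1ℚ :* y := r :* r :+ (r :* y :+ y)) refl r y ⟩
  r * r + (r * y + y)          ≤⟨ +-monoʳ-≤ (r * r) (+-monoˡ-≤ y (*-monoʳ 0≤y r≤1)) ⟩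
  r * r + (1ℚ * y + y)         ≡⟨ cong (λ z → r * r + (z + y)) (*-identityˡ y) ⟩
  r * r + (y + y)              ∎
  where
  open ≤-Reasoning
  open +-*-Solver

module _ {p : ℕ} .{{_ : NonZero p}} where

  private instance
    allFin≢0 : NonZero (length (allFin p))
    allFin≢0 = allFin-nonEmpty p

  𝔼ᵥ-cong : {f g : 𝔽^ p n → ℚ} → (∀ x → f x ≡ g x) → 𝔼ᵥ f ≡ 𝔼ᵥ g
  𝔼ᵥ-cong {n} = 𝔼-cong (all𝔽^ p n) {{all𝔽^-nonEmpty p n}}

  𝔼ᵥ-mono : {f g : 𝔽^ p n → ℚ} → (∀ x → f x ≤ g x) → 𝔼ᵥ f ≤ 𝔼ᵥ g
  𝔼ᵥ-mono {n} = 𝔼-mono (all𝔽^ p n) {{all𝔽^-nonEmpty p n}}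

  𝔼ᵥ-+ : (f g : 𝔽^ p n → ℚ) → 𝔼ᵥ (λ x → f x + g x) ≡ 𝔼ᵥ f + 𝔼ᵥ g
  𝔼ᵥ-+ {n} = 𝔼-+ (all𝔽^ p n) {{all𝔽^-nonEmpty p n}}

  𝔼ᵥ-*ˡ : ∀ c (f : 𝔽^ p n → ℚ) → 𝔼ᵥ (λ x → c * f x) ≡ c * 𝔼ᵥ f
  𝔼ᵥ-*ˡ {n} = 𝔼-*ˡ (all𝔽^ p n) {{all𝔽^-nonEmpty p n}}

  𝔼ᵥ-*ʳ : ∀ c (f : 𝔽^ p n → ℚ) → 𝔼ᵥ (λ x → f x * c) ≡ 𝔼ᵥ f * c
  𝔼ᵥ-*ʳ {n} = 𝔼-*ʳ (all𝔽^ p n) {{all𝔽^-nonEmpty p n}}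

  𝔼ᵥ-const : ∀ n c → 𝔼ᵥ {p} {n} (λ _ → c) ≡ c
  𝔼ᵥ-const n = 𝔼-const (all𝔽^ p n) {{all𝔽^-nonEmpty p n}}

  𝔼ᵥ-affine : ∀ b c (f : 𝔽^ p n → ℚ) → 𝔼ᵥ (λ x → b + c * f x) ≡ b + c * 𝔼ᵥ f
  𝔼ᵥ-affine {n} = 𝔼-affine (all𝔽^ p n) {{all𝔽^-nonEmpty p n}}

  𝔼ᵥ-upper : {f : 𝔽^ p n → ℚ} {c : ℚ} → (∀ x → f x ≤ c) → 𝔼ᵥ f ≤ c
  𝔼ᵥ-upper {n} = 𝔼-upper (all𝔽^ p n) {{all𝔽^-nonEmpty p n}}

  𝔼ᵥ-lower : {f : 𝔽^ p n → ℚ} {c : ℚ} → (∀ x → c ≤ f x) → c ≤ 𝔼ᵥ f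
  𝔼ᵥ-lower {n} = 𝔼-lower (all𝔽^ p n) {{all𝔽^-nonEmpty p n}}

  𝔼ᵥ-swap : ∀ {m n} (f : 𝔽^ p m → 𝔽^ p n → ℚ) → 𝔼ᵥ (λ x → 𝔼ᵥ (f x)) ≡ 𝔼ᵥ (λ y → 𝔼ᵥ (λ x → f x y))
  𝔼ᵥ-swap {m} {n} = 𝔼-swap (all𝔽^ p m) {{all𝔽^-nonEmpty p m}} (all𝔽^ p n) {{all𝔽^-nonEmpty p n}}

  𝔼ᵥ-translationˡ : ∀ (t : 𝔽^ p n) f → 𝔼ᵥ (λ x → f (t +ᵥ x)) ≡ 𝔼ᵥ f
  𝔼ᵥ-translationˡ {n} t f = trans (𝔼ᵥ-cong (λ x → cong f (zipWith-comm +ₚ-comm t x))) (𝔼ᵥ-translation n t f)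

  module U² {n} (g : 𝔽^ p n → ℚ) where

    correlation : 𝔽^ p n → ℚ
    correlation h = 𝔼ᵥ (λ x → g x * g (x +ᵥ h))

    𝔼-correlation : 𝔼ᵥ correlation ≡ 𝔼ᵥ g * 𝔼ᵥ g
    𝔼-correlation = begin
      𝔼ᵥ (λ h → 𝔼ᵥ (λ x → g x * g (x +ᵥ h)))    ≡⟨ 𝔼ᵥ-swap (λ h x → g x * g (x +ᵥ h)) ⟩
      𝔼ᵥ (λ x → 𝔼ᵥ (λ h → g x * g (x +ᵥ h)))    ≡⟨ 𝔼ᵥ-cong (λ x → 𝔼ᵥ-*ˡ (g x) (λ h → g (x +ᵥ h))) ⟩
      𝔼ᵥ (λ x → g x * 𝔼ᵥ (λ h → g (x +ᵥ h)))    ≡⟨ 𝔼ᵥ-cong (λ x → cong (g x *_) (𝔼ᵥ-translationˡ x g)) ⟩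
      𝔼ᵥ (λ x → g x * 𝔼ᵥ g)                     ≡⟨ 𝔼ᵥ-*ʳ (𝔼ᵥ g) g ⟩
      𝔼ᵥ g * 𝔼ᵥ g                               ∎
      where open ≡-Reasoning

    -- For fixed h the parallelogram consists of the pairs (x , x + h) and (x + h′ , x + h′ + h). As
    -- h′ varies the second pair is independent of the first, so the average factors into a square.
    ‖‖U²^4≡𝔼correlation² : ‖ g ‖U²^4 ≡ 𝔼ᵥ (λ h → correlation h * correlation h)
    ‖‖U²^4≡𝔼correlation² = begin
      𝔼ᵥ (λ x → 𝔼ᵥ (λ h → 𝔼ᵥ (λ h′ → g x * g (x +ᵥ h) * g (x +ᵥ h′) * g (x +ᵥ h +ᵥ h′))))
        ≡⟨ 𝔼ᵥ-cong (λ x → 𝔼ᵥ-cong (λ h → inner x h)) ⟩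
      𝔼ᵥ (λ x → 𝔼ᵥ (λ h → g x * g (x +ᵥ h) * correlation h))
        ≡⟨ 𝔼ᵥ-swap (λ x h → g x * g (x +ᵥ h) * correlation h) ⟩
      𝔼ᵥ (λ h → 𝔼ᵥ (λ x → g x * g (x +ᵥ h) * correlation h))
        ≡⟨ 𝔼ᵥ-cong (λ h → 𝔼ᵥ-*ʳ (correlation h) (λ x → g x * g (x +ᵥ h))) ⟩
      𝔼ᵥ (λ h → correlation h * correlation h) ∎
      where
      open ≡-Reasoning
      inner : ∀ x h → 𝔼ᵥ (λ h′ → g x * g (x +ᵥ h) * g (x +ᵥ h′) * g (x +ᵥ h +ᵥ h′)) ≡ g x * g (x +ᵥ h) * correlation h
      inner x h = begin
        𝔼ᵥ (λ h′ → g x * g (x +ᵥ h) * g (x +ᵥ h′) * g (x +ᵥ h +ᵥ h′))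
          ≡⟨ 𝔼ᵥ-cong (λ h′ → trans (*-assoc (g x * g (x +ᵥ h)) _ _) (cong (λ y → g x * g (x +ᵥ h) * (g (x +ᵥ h′) * g y)) (swap x h h′))) ⟩
        𝔼ᵥ (λ h′ → g x * g (x +ᵥ h) * (g (x +ᵥ h′) * g (x +ᵥ h′ +ᵥ h)))
          ≡⟨ 𝔼ᵥ-*ˡ (g x * g (x +ᵥ h)) (λ h′ → g (x +ᵥ h′) * g (x +ᵥ h′ +ᵥ h)) ⟩
        g x * g (x +ᵥ h) * 𝔼ᵥ (λ h′ → g (x +ᵥ h′) * g (x +ᵥ h′ +ᵥ h))
          ≡⟨ cong (g x * g (x +ᵥ h) *_) (𝔼ᵥ-translationˡ x (λ y → g y * g (y +ᵥ h))) ⟩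
        g x * g (x +ᵥ h) * correlation h ∎
        where
        swap : ∀ x h h′ → x +ᵥ h +ᵥ h′ ≡ x +ᵥ h′ +ᵥ h
        swap x h h′ = trans (zipWith-assoc +ₚ-assoc x h h′)
          (trans (cong (x +ᵥ_) (zipWith-comm +ₚ-comm h h′)) (sym (zipWith-assoc +ₚ-assoc x h′ h)))

  module _ (g : 𝔽^ p n → ℚ) {α : ℚ} (𝔼g≡α : 𝔼ᵥ g ≡ α) where

    private
      corr = U².correlation g

    correlation-centred : ∀ h → U².correlation (λ x → g x - α) h ≡ corr h - α * α
    correlation-centred h = begin
      𝔼ᵥ (λ x → (g x - α) * (g (x +ᵥ h) - α))
        ≡⟨ 𝔼ᵥ-cong (λ x → solve 3 (λ x y a → (x :- a) :* (y :- a) := x :* y :+ (a :* a :+ (:- a) :* (x :+ y))) refl (g x) (g (x +ᵥ h)) α) ⟩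
      𝔼ᵥ (λ x → g x * g (x +ᵥ h) + (α * α + (- α) * (g x + g (x +ᵥ h))))
        ≡⟨ 𝔼ᵥ-+ (λ x → g x * g (x +ᵥ h)) (λ x → α * α + (- α) * (g x + g (x +ᵥ h))) ⟩
      corr h + 𝔼ᵥ (λ x → α * α + (- α) * (g x + g (x +ᵥ h)))
        ≡⟨ cong (corr h +_) (𝔼ᵥ-affine (α * α) (- α) (λ x → g x + g (x +ᵥ h))) ⟩
      corr h + (α * α + (- α) * 𝔼ᵥ (λ x → g x + g (x +ᵥ h)))
        ≡⟨ cong (λ z → corr h + (α * α + (- α) * z)) (trans (𝔼ᵥ-+ g (λ x → g (x +ᵥ h)))
             (cong₂ _+_ 𝔼g≡α (trans (𝔼ᵥ-translation n h g) 𝔼g≡α))) ⟩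
      corr h + (α * α + (- α) * (α + α))
        ≡⟨ solve 2 (λ c a → c :+ (a :* a :+ (:- a) :* (a :+ a)) := c :- a :* a) refl (corr h) α ⟩
      corr h - α * α ∎
      where
      open ≡-Reasoning
      open +-*-Solver

    -- A variance identity: the correlation of g has mean α², and centring g subtracts exactly this
    -- mean from it.
    ‖centred‖U²^4 : ‖ (λ x → g x - α) ‖U²^4 ≡ 𝔼ᵥ (λ h → corr h * corr h) - α * α * (α * α)
    ‖centred‖U²^4 = begin
      ‖ (λ x → g x - α) ‖U²^4
        ≡⟨ U².‖‖U²^4≡𝔼correlation² (λ x → g x - α) ⟩
      𝔼ᵥ (λ h → U².correlation (λ x → g x - α) h * U².correlation (λ x → g x - α) h)
        ≡⟨ 𝔼ᵥ-cong (λ h → cong₂ _*_ (correlation-centred h) (correlation-centred h)) ⟩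
      𝔼ᵥ (λ h → (corr h - α²) * (corr h - α²))
        ≡⟨ 𝔼ᵥ-cong (λ h → solve 2 (λ c a → (c :- a) :* (c :- a) := c :* c :+ (a :* a :+ (:- (a :+ a)) :* c)) refl (corr h) α²) ⟩
      𝔼ᵥ (λ h → corr h * corr h + (α² * α² + (- (α² + α²)) * corr h))
        ≡⟨ 𝔼ᵥ-+ (λ h → corr h * corr h) (λ h → α² * α² + (- (α² + α²)) * corr h) ⟩
      𝔼ᵥ (λ h → corr h * corr h) + 𝔼ᵥ (λ h → α² * α² + (- (α² + α²)) * corr h)
        ≡⟨ cong (𝔼ᵥ (λ h → corr h * corr h) +_) (𝔼ᵥ-affine (α² * α²) (- (α² + α²)) corr) ⟩
      𝔼ᵥ (λ h → corr h * corr h) + (α² * α² + (- (α² + α²)) * 𝔼ᵥ corr)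
        ≡⟨ cong (λ z → 𝔼ᵥ (λ h → corr h * corr h) + (α² * α² + (- (α² + α²)) * z)) (trans (U².𝔼-correlation g) (cong₂ _*_ 𝔼g≡α 𝔼g≡α)) ⟩
      𝔼ᵥ (λ h → corr h * corr h) + (α² * α² + (- (α² + α²)) * α²)
        ≡⟨ solve 2 (λ c a → c :+ (a :* a :+ (:- (a :+ a)) :* a) := c :- a :* a) refl (𝔼ᵥ (λ h → corr h * corr h)) α² ⟩
      𝔼ᵥ (λ h → corr h * corr h) - α² * α² ∎
      where
      open ≡-Reasoning
      open +-*-Solver
      α² = α * α

  -- The indicator of (x , y) ≠ (s , t), written in the shape b + c * f so that `𝔼-affine` averages
  -- it in y and then in x.
  miss : (s t x y : 𝔽 p) → ℚ
  miss s t x y = 1ℚ + (- ind (s ≟ᶠ x)) * ind (t ≟ᶠ y)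

  0≤miss : ∀ s t x y → 0ℚ ≤ miss s t x y
  0≤miss s t x y with s ≟ᶠ x | t ≟ᶠ y
  ... | yes _ | yes _ = ≤-refl
  ... | yes _ | no _  = 0≤1
  ... | no _  | yes _ = 0≤1
  ... | no _  | no _  = 0≤1

  miss-or-hit : ∀ s t x y → miss s t x y ≡ 1ℚ ⊎ (x ≡ s × y ≡ t)
  miss-or-hit s t x y with s ≟ᶠ x | t ≟ᶠ y
  ... | yes s≡x | yes t≡y = inj₂ (sym s≡x , sym t≡y)
  ... | yes _   | no _    = inj₁ refl
  ... | no _    | yes _   = inj₁ refl
  ... | no _    | no _    = inj₁ refl

  -- The indicator of the event that (aᵢ , wᵢ) ≠ (s , t) for every i.  Pairs of
  -- vectors hitting both (1 , 0) and (0 , 1) are linearly independent, and this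
  -- simple sufficient condition already holds with probability tending to 1.
  avoids : 𝔽 p → 𝔽 p → 𝔽^ p n → 𝔽^ p n → ℚ
  avoids s t []      []      = 1ℚ
  avoids s t (x ∷ a) (y ∷ w) = miss s t x y * avoids s t a w

  0≤avoids : ∀ s t (a w : 𝔽^ p n) → 0ℚ ≤ avoids s t a w
  0≤avoids s t []      []      = 0≤1
  0≤avoids s t (x ∷ a) (y ∷ w) = 0≤* (0≤miss s t x y) (0≤avoids s t a w)

  -- At a position where the pair of coordinates equals (s , t), the basis vector of that position
  -- is the required e.
  avoids-or-attains : ∀ s t (a w : 𝔽^ p n) → avoids s t a w ≡ 1ℚ ⊎ ∃[ e ] dot a e ≡ s × dot w e ≡ t
  avoids-or-attains s t []      []      = inj₁ refl
  avoids-or-attains s t (x ∷ a) (y ∷ w) with miss-or-hit s t x y | avoids-or-attains s t a w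
  ... | inj₂ (x≡s , y≡t) | _ = inj₂ (basis zero , trans (dot-basis (x ∷ a) zero) x≡s , trans (dot-basis (y ∷ w) zero) y≡t)
  ... | inj₁ missed | inj₁ avoided = inj₁ (cong₂ _*_ missed avoided)
  ... | inj₁ _      | inj₂ (e , ae≡s , we≡t) = inj₂ (0ₚ ∷ e , trans (dot-0∷ x a) ae≡s , trans (dot-0∷ y w) we≡t)
    where
    dot-0∷ : ∀ z v → dot (z ∷ v) (0ₚ ∷ e) ≡ dot v e
    dot-0∷ z v = trans (cong (_+ₚ dot v e) (*ₚ-zeroʳ z)) (+ₚ-identityˡ (dot v e))

  -- The probability that n independent uniform pairs of residues all miss one prescribed pair.
  -- Every error term of the construction is a multiple of it.
  θ : ℕ → ℚ
  θ n = (1ℚ - ρ p * ρ p) ^ n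

  𝔼-avoids : ∀ n s t → 𝔼ᵥ {p} {n} (λ a → 𝔼ᵥ (avoids s t a)) ≡ θ n
  𝔼-avoids zero s t = trans (𝕍-zero (allFin p) (λ a → 𝔼ᵥ {p} {0} (avoids s t a))) (𝕍-zero (allFin p) (avoids s t []))
  𝔼-avoids (suc n) s t = begin
    𝔼ᵥ {p} {suc n} (λ a → 𝔼ᵥ (avoids s t a))
      ≡⟨ 𝕍-suc (allFin p) n (λ a → 𝔼ᵥ (avoids s t a)) ⟩
    𝔼 (allFin p) (λ x → 𝔼ᵥ {p} {n} (λ a → 𝔼ᵥ (avoids s t (x ∷ a))))
      ≡⟨ 𝔼-cong (allFin p) (λ x → trans (𝔼ᵥ-cong (factor x)) (𝔼ᵥ-*ˡ (1ℚ + (- ind (s ≟ᶠ x)) * ρ p) avoids-mean)) ⟩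
    𝔼 (allFin p) (λ x → (1ℚ + (- ind (s ≟ᶠ x)) * ρ p) * 𝔼ᵥ avoids-mean)
      ≡⟨ 𝔼-*ʳ (allFin p) (𝔼ᵥ avoids-mean) (λ x → 1ℚ + (- ind (s ≟ᶠ x)) * ρ p) ⟩
    𝔼 (allFin p) (λ x → 1ℚ + (- ind (s ≟ᶠ x)) * ρ p) * 𝔼ᵥ avoids-mean
      ≡⟨ cong (_* 𝔼ᵥ avoids-mean) (trans (𝔼-cong (allFin p) (λ x → cong (1ℚ +_) (flip (ind (s ≟ᶠ x)))))
           (trans (𝔼-affine (allFin p) 1ℚ (- ρ p) (λ x → ind (s ≟ᶠ x))) (cong (λ z → 1ℚ + (- ρ p) * z) (𝔼-point p s)))) ⟩
    (1ℚ + (- ρ p) * ρ p) * 𝔼ᵥ avoids-mean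
      ≡⟨ cong₂ (λ y z → (1ℚ + y) * z) (sym (neg-distribˡ-* (ρ p) (ρ p))) (𝔼-avoids n s t) ⟩
    θ (suc n) ∎
    where
    open ≡-Reasoning
    avoids-mean : 𝔽^ p n → ℚ
    avoids-mean a = 𝔼ᵥ (avoids s t a)
    flip : ∀ z → (- z) * ρ p ≡ (- ρ p) * z
    flip z = solve 2 (λ z r → (:- z) :* r := (:- r) :* z) refl z (ρ p)
      where open +-*-Solver
    factor : ∀ x a → 𝔼ᵥ (avoids s t (x ∷ a)) ≡ (1ℚ + (- ind (s ≟ᶠ x)) * ρ p) * avoids-mean a
    factor x a = begin
      𝔼ᵥ (avoids s t (x ∷ a))
        ≡⟨ 𝕍-suc (allFin p) n (avoids s t (x ∷ a)) ⟩
      𝔼 (allFin p) (λ y → 𝔼ᵥ (λ w → miss s t x y * avoids s t a w))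
        ≡⟨ 𝔼-cong (allFin p) (λ y → 𝔼ᵥ-*ˡ (miss s t x y) (avoids s t a)) ⟩
      𝔼 (allFin p) (λ y → miss s t x y * avoids-mean a)
        ≡⟨ 𝔼-*ʳ (allFin p) (avoids-mean a) (miss s t x) ⟩
      𝔼 (allFin p) (miss s t x) * avoids-mean a
        ≡⟨ cong (_* avoids-mean a) (trans (𝔼-affine (allFin p) 1ℚ (- ind (s ≟ᶠ x)) (λ y → ind (t ≟ᶠ y)))
             (cong (λ z → 1ℚ + (- ind (s ≟ᶠ x)) * z) (𝔼-point p t))) ⟩
      (1ℚ + (- ind (s ≟ᶠ x)) * ρ p) * avoids-mean a ∎

  ρ≥0 : 0ℚ ≤ ρ p
  ρ≥0 = <⇒≤ (0<unitFraction p)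

  -- Here w is an auxiliary vector, later averaged out. A coordinate 1 in a makes b ↦ a · b
  -- surjective; asking for it opposite a coordinate 0 of w lets the estimate for pairs be reused
  -- for a single vector.
  isotropic-density : ∀ (a w : 𝔽^ p n) → 𝔼ᵥ (λ b → ind (dot a b ≟ᶠ 0ₚ)) ≤ ρ p + avoids 1ₚ 0ₚ a w
  isotropic-density {n} a w with avoids-or-attains 1ₚ 0ₚ a w
  ... | inj₁ avoided = begin
    𝔼ᵥ (λ b → ind (dot a b ≟ᶠ 0ₚ))   ≤⟨ 𝔼ᵥ-upper (λ b → ind≤1 (dot a b ≟ᶠ 0ₚ)) ⟩
    1ℚ                               ≤⟨ ≤-+ˡ 1ℚ ρ≥0 ⟩
    ρ p + 1ℚ                         ≡⟨ cong (ρ p +_) avoided ⟨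
    ρ p + avoids 1ₚ 0ₚ a w           ∎
    where open ≤-Reasoning
  ... | inj₂ (e , ae≡1 , _) = begin
    𝔼ᵥ (λ b → ind (dot a b ≟ᶠ 0ₚ))   ≡⟨ dot-kernel-surjective a (λ y → y ·ᵥ e , trans (dot-·ʳ y a e) (trans (cong (y *ₚ_) ae≡1) (*ₚ-identityʳ y))) ⟩
    ρ p                              ≤⟨ ≤-+ʳ (ρ p) (0≤avoids 1ₚ 0ₚ a w) ⟩
    ρ p + avoids 1ₚ 0ₚ a w           ∎
    where open ≤-Reasoning

  -- A union bound for the failure of either of the two sufficient conditions for independence.
  degenerate : 𝔽^ p n → 𝔽^ p n → ℚ
  degenerate a w = avoids 1ₚ 0ₚ a w + avoids 0ₚ 1ₚ a w

  0≤degenerate : ∀ (a w : 𝔽^ p n) → 0ℚ ≤ degenerate a w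
  0≤degenerate a w = 0≤+ (0≤avoids 1ₚ 0ₚ a w) (0≤avoids 0ₚ 1ₚ a w)

  ind*ind≤1 : ∀ {P Q : Set} (P? : Dec P) (Q? : Dec Q) → ind P? * ind Q? ≤ 1ℚ
  ind*ind≤1 P? Q? = *-mono 0≤1 (0≤ind Q?) (ind≤1 P?) (ind≤1 Q?)

  -- If one of the two patterns is avoided, the right side is at least 1 and the bound is trivial.
  -- Otherwise e and e′ form a dual system for a and w, so b ↦ (a · b , w · b) is onto and its
  -- kernel has density exactly ρ².
  joint-isotropic-density : ∀ (a w v : 𝔽^ p n) →
    𝔼ᵥ (λ b → ind (dot a b ≟ᶠ 0ₚ) * ind (dot w (b +ᵥ v) ≟ᶠ 0ₚ)) ≤ ρ p * ρ p + degenerate a w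
  joint-isotropic-density {n} a w v with avoids-or-attains 1ₚ 0ₚ a w | avoids-or-attains 0ₚ 1ₚ a w
  ... | inj₁ avoided | _ =
    ≤-trans (𝔼ᵥ-upper (λ b → ind*ind≤1 (dot a b ≟ᶠ 0ₚ) (dot w (b +ᵥ v) ≟ᶠ 0ₚ)))
    (≤-trans (subst (_≤ degenerate a w) avoided (≤-+ʳ _ (0≤avoids 0ₚ 1ₚ a w))) (≤-+ˡ (degenerate a w) (0≤* ρ≥0 ρ≥0)))
  ... | inj₂ _ | inj₁ avoided =
    ≤-trans (𝔼ᵥ-upper (λ b → ind*ind≤1 (dot a b ≟ᶠ 0ₚ) (dot w (b +ᵥ v) ≟ᶠ 0ₚ)))
    (≤-trans (subst (_≤ degenerate a w) avoided (≤-+ˡ _ (0≤avoids 1ₚ 0ₚ a w))) (≤-+ˡ (degenerate a w) (0≤* ρ≥0 ρ≥0)))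
  ... | inj₂ (e , ae≡1 , we≡0) | inj₂ (e′ , ae′≡0 , we′≡1) = begin
    𝔼ᵥ (λ b → ind (dot a b ≟ᶠ 0ₚ) * ind (dot w (b +ᵥ v) ≟ᶠ 0ₚ))
      ≡⟨ 𝔼ᵥ-cong (λ b → sym (ind-× (dot a b ≟ᶠ 0ₚ) (dot w (b +ᵥ v) ≟ᶠ 0ₚ) (φ b +ᵥ φ b₀ ≟ᵥ 0ᵥ) (split b) (join b))) ⟩
    𝔼ᵥ (λ b → ind (φ b +ᵥ φ b₀ ≟ᵥ 0ᵥ))
      ≡⟨ shifted-kernel b₀ ⟩
    kernel
      ≡⟨ kernel-surjective (λ { (y ∷ z ∷ []) → solution y z , φ-solution y z }) ⟩
    ρ p * (ρ p * 1ℚ)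
      ≡⟨ cong (ρ p *_) (*-identityʳ (ρ p)) ⟩
    ρ p * ρ p
      ≤⟨ ≤-+ʳ (ρ p * ρ p) (0≤degenerate a w) ⟩
    ρ p * ρ p + degenerate a w ∎
    where
    open ≤-Reasoning
    φ : 𝔽^ p n → 𝔽^ p 2
    φ b = dot a b ∷ dot w b ∷ []
    open Fibre (all𝔽^ p n) {{all𝔽^-nonEmpty p n}} _+ᵥ_ (𝔼ᵥ-translation n) φ
      (λ b c → cong₂ (λ y z → y ∷ z ∷ []) (dot-+ʳ a b c) (dot-+ʳ w b c))
    solution : 𝔽 p → 𝔽 p → 𝔽^ p n
    solution y z = y ·ᵥ e +ᵥ z ·ᵥ e′
    dot-solution : ∀ u y z → dot u (solution y z) ≡ y *ₚ dot u e +ₚ z *ₚ dot u e′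
    dot-solution u y z = trans (dot-+ʳ u (y ·ᵥ e) (z ·ᵥ e′)) (cong₂ _+ₚ_ (dot-·ʳ y u e) (dot-·ʳ z u e′))
    a-solution : ∀ y z → dot a (solution y z) ≡ y
    a-solution y z = trans (dot-solution a y z) (trans
      (cong₂ _+ₚ_ (trans (cong (y *ₚ_) ae≡1) (*ₚ-identityʳ y)) (trans (cong (z *ₚ_) ae′≡0) (*ₚ-zeroʳ z))) (+ₚ-identityʳ y))
    w-solution : ∀ y z → dot w (solution y z) ≡ z
    w-solution y z = trans (dot-solution w y z) (trans
      (cong₂ _+ₚ_ (trans (cong (y *ₚ_) we≡0) (*ₚ-zeroʳ y)) (trans (cong (z *ₚ_) we′≡1) (*ₚ-identityʳ z))) (+ₚ-identityˡ z))
    φ-solution : ∀ y z → φ (solution y z) ≡ y ∷ z ∷ []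
    φ-solution y z = cong₂ (λ y z → y ∷ z ∷ []) (a-solution y z) (w-solution y z)
    -- Chosen so that φ b₀ = (0 , w · v): adding it reproduces the shift by v in the second
    -- condition and leaves the first unchanged.
    b₀ = solution 0ₚ (dot w v)
    shift-a : ∀ b → dot a b +ₚ dot a b₀ ≡ dot a b
    shift-a b = trans (cong (dot a b +ₚ_) (a-solution 0ₚ (dot w v))) (+ₚ-identityʳ (dot a b))
    shift-w : ∀ b → dot w b +ₚ dot w b₀ ≡ dot w (b +ᵥ v)
    shift-w b = trans (cong (dot w b +ₚ_) (w-solution 0ₚ (dot w v))) (sym (dot-+ʳ w b v))
    split : ∀ b → φ b +ᵥ φ b₀ ≡ 0ᵥ → dot a b ≡ 0ₚ × dot w (b +ᵥ v) ≡ 0ₚ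
    split b eq = let eq₁ , eq₂ = ∷-injective eq in
      trans (sym (shift-a b)) eq₁ , trans (sym (shift-w b)) (proj₁ (∷-injective eq₂))
    join : ∀ b → dot a b ≡ 0ₚ → dot w (b +ᵥ v) ≡ 0ₚ → φ b +ᵥ φ b₀ ≡ 0ᵥ
    join b eq₁ eq₂ = cong₂ (λ y z → y ∷ z ∷ []) (trans (shift-a b) eq₁) (trans (shift-w b) eq₂)

-- The hyperbolic quadric: density, uniformity, and solution counts

module Hyperbolic {p : ℕ} .{{_ : NonZero p}} (k : ℕ) where

  private instance
    allFin≢0 : NonZero (length (allFin p))
    allFin≢0 = allFin-nonEmpty p

  -- The split quadratic form in k + k variables, a sum of k hyperbolic planes; it is linear in each
  -- half separately.
  form : 𝔽^ p (k ℕ.+ k) → 𝔽 p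
  form x = dot (take k x) (drop k x)

  form-++ : ∀ a b → form (a ++ b) ≡ dot a b
  form-++ a b = let eq₁ , eq₂ = ++-injective (take k (a ++ b)) a (take++drop≡id k (a ++ b)) in cong₂ dot eq₁ eq₂

  Null : Pred (𝔽^ p (k ℕ.+ k)) 0ℓ
  Null x = form x ≡ 0ₚ

  null? : Decidable Null
  null? x = form x ≟ᶠ 0ₚ

  g : 𝔽^ p (k ℕ.+ k) → ℚ
  g = indicator null?

  α : ℚ
  α = density null?

  𝔼g≡α : 𝔼ᵥ g ≡ α
  𝔼g≡α = sym (Pr≡𝔼 (all𝔽^ p (k ℕ.+ k)) {{all𝔽^-nonEmpty p (k ℕ.+ k)}} null?)

  g-++ : ∀ a b → g (a ++ b) ≡ ind (dot a b ≟ᶠ 0ₚ)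
  g-++ a b = cong (λ z → ind (z ≟ᶠ 0ₚ)) (form-++ a b)

  α-fibred : α ≡ 𝔼ᵥ {p} {k} (λ a → 𝔼ᵥ (λ b → ind (dot a b ≟ᶠ 0ₚ)))
  α-fibred = trans (sym 𝔼g≡α) (trans (𝕍-+-split (allFin p) k k g) (𝔼ᵥ-cong {n = k} (λ a → 𝔼ᵥ-cong {n = k} (λ b → g-++ a b))))

  ρ≤α : ρ p ≤ α
  ρ≤α = subst (ρ p ≤_) (sym α-fibred) (𝔼ᵥ-lower {n = k} ρ≤dot-kernel)

  0≤α : 0ℚ ≤ α
  0≤α = ≤-trans ρ≥0 ρ≤α

  α≤1 : α ≤ 1ℚ
  α≤1 = subst (_≤ 1ℚ) 𝔼g≡α (𝔼ᵥ-upper (λ x → ind≤1 (null? x)))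

  α≤ρ+θ : α ≤ ρ p + θ {p} k
  α≤ρ+θ = begin
    α                                                         ≡⟨ α-fibred ⟩
    -- The left side does not involve w, so a bound valid for every w may be averaged over w.
    𝔼ᵥ {p} {k} (λ a → 𝔼ᵥ (λ b → ind (dot a b ≟ᶠ 0ₚ)))         ≤⟨ 𝔼ᵥ-mono {n = k} (λ a → 𝔼ᵥ-lower {n = k} (isotropic-density a)) ⟩
    𝔼ᵥ {p} {k} (λ a → 𝔼ᵥ {p} {k} (λ w → ρ p + avoids 1ₚ 0ₚ a w))
      ≡⟨ 𝔼ᵥ-cong {n = k} (λ a → trans (𝔼ᵥ-+ {n = k} (λ _ → ρ p) (avoids 1ₚ 0ₚ a)) (cong (_+ 𝔼ᵥ (avoids 1ₚ 0ₚ a)) (𝔼ᵥ-const k (ρ p)))) ⟩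
    𝔼ᵥ {p} {k} (λ a → ρ p + 𝔼ᵥ (avoids 1ₚ 0ₚ a))
      ≡⟨ trans (𝔼ᵥ-+ {n = k} (λ _ → ρ p) (λ a → 𝔼ᵥ (avoids 1ₚ 0ₚ a))) (cong₂ _+_ (𝔼ᵥ-const k (ρ p)) (𝔼-avoids k 1ₚ 0ₚ)) ⟩
    ρ p + θ {p} k ∎
    where open ≤-Reasoning

  ρ≤1 : ρ p ≤ 1ℚ
  ρ≤1 = ≤-trans ρ≤α α≤1

  corr : 𝔽^ p (k ℕ.+ k) → ℚ
  corr = U².correlation g

  0≤corr : ∀ h → 0ℚ ≤ corr h
  0≤corr h = 𝔼ᵥ-lower (λ x → 0≤* (0≤ind (null? x)) (0≤ind (null? (x +ᵥ h))))

  corr≤1 : ∀ h → corr h ≤ 1ℚ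
  corr≤1 h = 𝔼ᵥ-upper (λ x → ind*ind≤1 (null? x) (null? (x +ᵥ h)))

  -- The error in the correlation at the shift (u , v). The estimate for pairs is uniform in v, so
  -- only u remains.
  D : 𝔽^ p k → ℚ
  D u = 𝔼ᵥ (λ a → degenerate a (a +ᵥ u))

  0≤D : ∀ u → 0ℚ ≤ D u
  0≤D u = 𝔼ᵥ-lower (λ a → 0≤degenerate a (a +ᵥ u))

  corr≤ρ²+D : ∀ u v → corr (u ++ v) ≤ ρ p * ρ p + D u
  corr≤ρ²+D u v = begin
    corr (u ++ v)
      ≡⟨ 𝕍-+-split (allFin p) k k (λ x → g x * g (x +ᵥ (u ++ v))) ⟩
    𝔼ᵥ {p} {k} (λ a → 𝔼ᵥ {p} {k} (λ b → g (a ++ b) * g ((a ++ b) +ᵥ (u ++ v))))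
      ≡⟨ 𝔼ᵥ-cong {n = k} (λ a → 𝔼ᵥ-cong {n = k} (λ b → cong₂ _*_ (g-++ a b)
           (trans (cong g (zipWith-++ _+ₚ_ a b u v)) (g-++ (a +ᵥ u) (b +ᵥ v))))) ⟩
    𝔼ᵥ {p} {k} (λ a → 𝔼ᵥ (λ b → ind (dot a b ≟ᶠ 0ₚ) * ind (dot (a +ᵥ u) (b +ᵥ v) ≟ᶠ 0ₚ)))
      ≤⟨ 𝔼ᵥ-mono {n = k} (λ a → joint-isotropic-density a (a +ᵥ u) v) ⟩
    𝔼ᵥ (λ a → ρ p * ρ p + degenerate a (a +ᵥ u))
      ≡⟨ trans (𝔼ᵥ-+ {n = k} (λ _ → ρ p * ρ p) (λ a → degenerate a (a +ᵥ u))) (cong (_+ D u) (𝔼ᵥ-const k (ρ p * ρ p))) ⟩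
    ρ p * ρ p + D u ∎
    where open ≤-Reasoning

  -- For fixed a the vector a + u is uniform, so a and a + u behave as an independent pair, and each
  -- of the two bad patterns contributes θ.
  𝔼D : 𝔼ᵥ D ≡ θ {p} k + θ {p} k
  𝔼D = begin
    𝔼ᵥ {p} {k} (λ u → 𝔼ᵥ {p} {k} (λ a → degenerate a (a +ᵥ u)))       ≡⟨ 𝔼ᵥ-swap {m = k} {n = k} (λ u a → degenerate a (a +ᵥ u)) ⟩
    𝔼ᵥ {p} {k} (λ a → 𝔼ᵥ {p} {k} (λ u → degenerate a (a +ᵥ u)))       ≡⟨ 𝔼ᵥ-cong {n = k} (λ a → 𝔼ᵥ-translationˡ a (degenerate a)) ⟩
    𝔼ᵥ {p} {k} (λ a → 𝔼ᵥ (degenerate a))              ≡⟨ 𝔼ᵥ-cong {n = k} (λ a → 𝔼ᵥ-+ {n = k} (avoids 1ₚ 0ₚ a) (avoids 0ₚ 1ₚ a)) ⟩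
    𝔼ᵥ {p} {k} (λ a → 𝔼ᵥ (avoids 1ₚ 0ₚ a) + 𝔼ᵥ (avoids 0ₚ 1ₚ a))
      ≡⟨ 𝔼ᵥ-+ {n = k} (λ a → 𝔼ᵥ (avoids 1ₚ 0ₚ a)) (λ a → 𝔼ᵥ (avoids 0ₚ 1ₚ a)) ⟩
    𝔼ᵥ {p} {k} (λ a → 𝔼ᵥ (avoids 1ₚ 0ₚ a)) + 𝔼ᵥ {p} {k} (λ a → 𝔼ᵥ (avoids 0ₚ 1ₚ a))
      ≡⟨ cong₂ _+_ (𝔼-avoids k 1ₚ 0ₚ) (𝔼-avoids k 0ₚ 1ₚ) ⟩
    θ {p} k + θ {p} k                                 ∎
    where open ≡-Reasoning

  -- The constant 4 arises because squaring doubles the error D, whose mean is itself 2 θ. Since α⁴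
  -- is subtracted, ρ ≤ α allows its replacement by ρ⁴, which then cancels.
  U²-small : ‖ balanced null? ‖U²^4 ≤ 4 · θ {p} k
  U²-small = begin
    ‖ balanced null? ‖U²^4
      ≡⟨ ‖centred‖U²^4 g 𝔼g≡α ⟩
    𝔼ᵥ (λ h → corr h * corr h) - α * α * (α * α)
      ≤⟨ +-mono-≤ 𝔼corr²≤ (neg-antimono-≤ (*-mono (0≤* 0≤α 0≤α) (0≤* ρ≥0 ρ≥0) ρ²≤α² ρ²≤α²)) ⟩
    (ρ⁴ + (𝔼ᵥ D + 𝔼ᵥ D)) - ρ⁴
      ≡⟨ cong (λ z → (ρ⁴ + (z + z)) - ρ⁴) 𝔼D ⟩
    (ρ⁴ + (t + t + (t + t))) - ρ⁴
      ≡⟨ solve 2 (λ r t → (r :+ (t :+ t :+ (t :+ t))) :- r := t :+ (t :+ (t :+ (t :+ con 0ℚ)))) refl ρ⁴ t ⟩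
    4 · t ∎
    where
    open ≤-Reasoning
    open +-*-Solver
    t = θ {p} k
    ρ⁴ = ρ p * ρ p * (ρ p * ρ p)
    ρ²≤α² : ρ p * ρ p ≤ α * α
    ρ²≤α² = *-mono 0≤α ρ≥0 ρ≤α ρ≤α
    ρ²≤1 : ρ p * ρ p ≤ 1ℚ
    ρ²≤1 = *-mono 0≤1 ρ≥0 ρ≤1 ρ≤1
    𝔼corr²≤ : 𝔼ᵥ (λ h → corr h * corr h) ≤ ρ⁴ + (𝔼ᵥ D + 𝔼ᵥ D)
    𝔼corr²≤ = begin
      𝔼ᵥ (λ h → corr h * corr h)
        ≡⟨ 𝕍-+-split (allFin p) k k (λ h → corr h * corr h) ⟩
      𝔼ᵥ {p} {k} (λ u → 𝔼ᵥ {p} {k} (λ v → corr (u ++ v) * corr (u ++ v)))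
        ≤⟨ 𝔼ᵥ-mono {n = k} (λ u → 𝔼ᵥ-upper {n = k} (λ v → square-bound (0≤corr (u ++ v)) (corr≤1 (u ++ v)) (0≤* ρ≥0 ρ≥0) ρ²≤1 (0≤D u) (corr≤ρ²+D u v))) ⟩
      𝔼ᵥ (λ u → ρ⁴ + (D u + D u))
        ≡⟨ 𝔼ᵥ-+ {n = k} (λ _ → ρ⁴) (λ u → D u + D u) ⟩
      𝔼ᵥ {p} {k} (λ _ → ρ⁴) + 𝔼ᵥ (λ u → D u + D u)
        ≡⟨ cong₂ _+_ (𝔼ᵥ-const k ρ⁴) (𝔼ᵥ-+ {n = k} D D) ⟩
      ρ⁴ + (𝔼ᵥ D + 𝔼ᵥ D) ∎

  module _ (p-prime : Prime p) {d m} (L : Fin m → LinearForm p d) (c : Fin m → 𝔽 p) (i : Fin m) (cᵢ≢0 : c i ≢ 0ₚ)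
           (dep : ∀ r s → sumₚ (λ i → c i *ₚ Γ (L i) r s) ≡ 0ₚ) where

    private
      Tuple : Set
      Tuple = Vec (𝔽^ p k) d

      all-null? : (x : Vec (𝔽^ p (k ℕ.+ k)) d) → Dec (∀ i → Null (eval (L i) x))
      all-null? x = all? (λ i → null? (eval (L i) x))

      φ : Tuple → Tuple → 𝔽^ p m
      φ a b = tabulate (λ i → dot (eval (L i) a) (eval (L i) b))

      φ-+ : ∀ a b b′ → φ a (zipWith _+ᵥ_ b b′) ≡ φ a b +ᵥ φ a b′
      φ-+ a b b′ = trans (tabulate-cong (λ i → trans (cong (dot (eval (L i) a)) (eval-+ (L i) b b′)) (dot-+ʳ (eval (L i) a) _ _)))
        (tabulate-+ (λ i → dot (eval (L i) a) (eval (L i) b)) (λ i → dot (eval (L i) a) (eval (L i) b′)))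

      -- With the first halves a fixed, the values at all the forms are additive in the tuple b of
      -- second halves, so simultaneous nullity is membership in a kernel.
      module F (a : Tuple) = Fibre (allTuples p k d) {{allTuples-nonEmpty p k d}} (zipWith _+ᵥ_)
        (𝕍-translation (all𝔽^ p k) {{all𝔽^-nonEmpty p k}} _+ᵥ_ (𝔼ᵥ-translation k) d) (φ a) (φ-+ a)

      form-eval : ∀ i a b → form (eval (L i) (zipWith _++_ a b)) ≡ dot (eval (L i) a) (eval (L i) b)
      form-eval i a b = trans (cong form (eval-++ (L i) a b)) (form-++ (eval (L i) a) (eval (L i) b))

      all-null⇒kernel : ∀ a b → (∀ i → Null (eval (L i) (zipWith _++_ a b))) → φ a b ≡ 0ᵥ
      all-null⇒kernel a b null = trans (tabulate-cong (λ i → trans (sym (form-eval i a b)) (null i))) (tabulate-0 m)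
        where
        tabulate-0 : ∀ m → tabulate {n = m} (λ _ → 0ₚ) ≡ 0ᵥ
        tabulate-0 zero    = refl
        tabulate-0 (suc m) = cong (0ₚ ∷_) (tabulate-0 m)

      kernel⇒all-null : ∀ a b → φ a b ≡ 0ᵥ → ∀ i → Null (eval (L i) (zipWith _++_ a b))
      kernel⇒all-null a b eq i = trans (form-eval i a b)
        (trans (sym (lookup∘tabulate (λ i → dot (eval (L i) a) (eval (L i) b)) i)) (trans (cong (λ v → lookup v i) eq) (lookup-replicate i 0ₚ)))

    Pr-all-null : Pr-tuple all-null? ≡ 𝔼 (allTuples p k d) {{allTuples-nonEmpty p k d}} F.kernel
    Pr-all-null = begin
      Pr-tuple all-null?
        ≡⟨ Pr≡𝔼 (allTuples p (k ℕ.+ k) d) {{allTuples-nonEmpty p (k ℕ.+ k) d}} all-null? ⟩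
      𝔼 (allTuples p (k ℕ.+ k) d) {{allTuples-nonEmpty p (k ℕ.+ k) d}} (λ x → ind (all-null? x))
        ≡⟨ 𝕍-zipWith-split (all𝔽^ p k) (all𝔽^ p k) (all𝔽^ p (k ℕ.+ k)) {{all𝔽^-nonEmpty p k}} {{all𝔽^-nonEmpty p k}} {{all𝔽^-nonEmpty p (k ℕ.+ k)}}
             _++_ (𝕍-+-split (allFin p) k k) d (λ x → ind (all-null? x)) ⟩
      𝔼 (allTuples p k d) {{allTuples-nonEmpty p k d}} (λ a → 𝔼 (allTuples p k d) {{allTuples-nonEmpty p k d}} (λ b → ind (all-null? (zipWith _++_ a b))))
        ≡⟨ 𝔼-cong (allTuples p k d) {{allTuples-nonEmpty p k d}} (λ a → 𝔼-cong (allTuples p k d) {{allTuples-nonEmpty p k d}}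
             (λ b → ind-cong (all-null? (zipWith _++_ a b)) (φ a b ≟ᵥ 0ᵥ) (all-null⇒kernel a b) (kernel⇒all-null a b))) ⟩
      𝔼 (allTuples p k d) {{allTuples-nonEmpty p k d}} F.kernel ∎
      where open ≡-Reasoning

    -- The hyperplane with normal vector `tabulate c` is the same for every a, so the kernel
    -- estimate holds for each a and hence on average.
    Pr-all-null≥ : ρ p ^ m ≤ ρ p * Pr-tuple all-null?
    Pr-all-null≥ = begin
      ρ p ^ m
        ≤⟨ 𝔼-lower (allTuples p k d) {{allTuples-nonEmpty p k d}} (λ a → kernel-of-map-into-hyperplane (allTuples p k d) {{allTuples-nonEmpty p k d}} (zipWith _+ᵥ_)
             (𝕍-translation (all𝔽^ p k) {{all𝔽^-nonEmpty p k}} _+ᵥ_ (𝔼ᵥ-translation k) d) (φ a) (φ-+ a) (tabulate c)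
             (dot-surjective p-prime (tabulate c) i (λ eq → cᵢ≢0 (trans (sym (lookup∘tabulate c i)) eq)))
             (λ b → trans (dot-tabulate c (λ i → dot (eval (L i) a) (eval (L i) b))) (dependence⇒relation L c dep a b))) ⟩
      𝔼 (allTuples p k d) {{allTuples-nonEmpty p k d}} (λ a → ρ p * F.kernel a)
        ≡⟨ 𝔼-*ˡ (allTuples p k d) {{allTuples-nonEmpty p k d}} (ρ p) F.kernel ⟩
      ρ p * 𝔼 (allTuples p k d) {{allTuples-nonEmpty p k d}} F.kernel
        ≡⟨ cong (ρ p *_) Pr-all-null ⟨
      ρ p * Pr-tuple all-null? ∎
      where open ≤-Reasoning

-- Choice of the constants

ρ+ρ≤1 : ∀ p .{{_ : NonZero p}} → 1 ℕ.< p → ρ p + ρ p ≤ 1ℚ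
ρ+ρ≤1 p@(suc (suc j)) (s≤s (s≤s z≤n)) = begin
  ρ p + ρ p              ≤⟨ +-monoʳ-≤ (ρ p) (≤-+ʳ (ρ p) (0≤· j (ρ≥0 {p}))) ⟩
  ρ p + (ρ p + j · ρ p)  ≡⟨ ·-unitFraction p p ⟩
  ℤ.+ p / p              ≡⟨ n/n≡1 p ⟩
  1ℚ                     ∎
  where open ≤-Reasoning

-- The threshold is x / (n + 1); the extra copy keeps the denominator positive when n = 0.
small-multiple : ∀ n {x} → 0ℚ < x → ∃[ y ] 0ℚ < y × (∀ {z} → 0ℚ ≤ z → z ≤ y → n · z ≤ x)
small-multiple n {x} 0<x = w * x , 0<* (0<unitFraction (suc n)) 0<x , λ {z} 0≤z z≤y → begin
  n · z               ≤⟨ ≤-+ˡ (n · z) 0≤z ⟩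
  suc n · z           ≤⟨ ·-mono-≤ (suc n) z≤y ⟩
  suc n · (w * x)     ≡⟨ ·-*ʳ (suc n) w x ⟨
  (suc n · w) * x     ≡⟨ cong (_* x) (trans (·-unitFraction (suc n) (suc n)) (n/n≡1 (suc n))) ⟩
  1ℚ * x              ≡⟨ *-identityˡ x ⟩
  x                   ∎
  where
  open ≤-Reasoning
  w = ℤ.+ 1 / suc n

0<⊓ : ∀ {x y} → 0ℚ < x → 0ℚ < y → 0ℚ < x ⊓ y
0<⊓ {x} {y} 0<x 0<y with ⊓-sel x y
... | inj₁ eq = subst (0ℚ <_) (sym eq) 0<x
... | inj₂ eq = subst (0ℚ <_) (sym eq) 0<y

theorem3p1 : (p : ℕ) .{{_ : NonZero p}} → Prime p → 2 ∤ p →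
    (d m : ℕ) (L : Fin m → LinearForm p d) →
    LinearlyDependent (λ i → Γ (L i)) →
    Σ[ ε ∈ ℚ ] (0ℚ < ε) × ((δ : ℚ) → 0ℚ < δ →
    Σ[ n ∈ ℕ ] Σ[ A ∈ Pred (𝔽^ p n) 0ℓ ] Σ[ A? ∈ Decidable A ]
    (‖ balanced A? ‖U²≤ δ) ×
    (Pr-tuple (λ (x : Vec (𝔽^ p n) d) → all? (λ i → A? (eval (L i) x))) ≥ (density A? ^ m) + ε))
theorem3p1 p p-prime _ d m L (c , (i , cᵢ≢0) , dep) = ε , 0<ε , λ δ 0<δ →
  let y₁ , 0<y₁ , bound₁ = small-multiple m 0<ε
      y₂ , 0<y₂ , bound₂ = small-multiple 4 (0<^ 4 0<δ)
      -- One k serves both requirements: m θ ≤ ε controls the density, and 4 θ ≤ δ⁴ controls the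
      -- fourth power of the norm.
      k , θ≤ = powers-vanish (0<* 0<ρ 0<ρ) ρ²≤1 (0<⊓ 0<y₁ 0<y₂)
      open Hyperbolic k
      0≤θ = 0≤^ k (p≤q⇒0≤q-p ρ²≤1)
  in k ℕ.+ k , Null , null?
   , ≤-trans U²-small (bound₂ 0≤θ (≤-trans θ≤ (p⊓q≤q y₁ y₂)))
   , lower (^-perturb 0≤α α≤1 ρ≥0 ρ≤1′ 0≤θ α≤ρ+θ m) (bound₁ 0≤θ (≤-trans θ≤ (p⊓q≤p y₁ y₂)))
           (Pr-all-null≥ p-prime L c i cᵢ≢0 dep)
  where
  p>1 : 1 ℕ.< p
  p>1 = nonTrivial⇒n>1 p {{prime⇒nonTrivial p-prime}}
  0<ρ = 0<unitFraction p
  -- The solution probability is at least 2 ρ^m. Half of the surplus ρ^m is ε, and the other half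
  -- absorbs the excess of α^m over ρ^m.
  ε = ½ * ρ p ^ m
  0<ε : 0ℚ < ε
  0<ε = 0<* (positive⁻¹ ½) (0<^ m 0<ρ)
  ρ≤1′ : ρ p ≤ 1ℚ
  ρ≤1′ = ≤-trans (≤-+ʳ (ρ p) (ρ≥0 {p})) (ρ+ρ≤1 p p>1)
  ρ²≤1 : ρ p * ρ p ≤ 1ℚ
  ρ²≤1 = *-mono 0≤1 ρ≥0 ρ≤1′ ρ≤1′
  lower : ∀ {α^m mθ P} → α^m ≤ ρ p ^ m + mθ → mθ ≤ ε → ρ p ^ m ≤ ρ p * P → P ≥ α^m + ε
  lower {α^m} {mθ} {P} α^m≤ mθ≤ε r≤ρP = begin
    α^m + ε                      ≤⟨ +-monoˡ-≤ ε (≤-trans α^m≤ (+-monoʳ-≤ (ρ p ^ m) mθ≤ε)) ⟩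
    ρ p ^ m + ε + ε              ≡⟨ solve 1 (λ r → r :+ con ½ :* r :+ con ½ :* r := r :+ r) refl (ρ p ^ m) ⟩
    -- Each copy of ρ^m is at most ρ P, and 2 ρ ≤ 1 because p is at least 2.
    ρ p ^ m + ρ p ^ m            ≤⟨ +-mono-≤ r≤ρP r≤ρP ⟩
    ρ p * P + ρ p * P            ≡⟨ *-distribʳ-+ P (ρ p) (ρ p) ⟨
    (ρ p + ρ p) * P              ≤⟨ *-monoʳ 0≤P (ρ+ρ≤1 p p>1) ⟩
    1ℚ * P                       ≡⟨ *-identityˡ P ⟩
    P                            ∎
    where
    open ≤-Reasoning
    open +-*-Solver
    0≤P : 0ℚ ≤ P
    0≤P = *-cancelˡ-≤-pos (ρ p) {{positive 0<ρ}}
      (subst (_≤ ρ p * P) (sym (*-zeroʳ (ρ p))) (≤-trans (0≤^ m (ρ≥0 {p})) r≤ρP))
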